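{- If $G$ is a normal graph with maximum degree $\Delta(G)$, then $\chi'_a(G)\leqslant \frac{5}{2}(\Delta(G)+2)$.
   Context: All graphs are finite, without self-loops or multiple edges, and without isolated vertices. $\Delta(G)$ denotes the maximum degree of a vertex of $G$. A graph $G$ is normal if it contains no isolated edges (an isolated edge is an edge both of whose end vertices have degree $1$, i.e. an edge forming a connected component by itself). An edge $k$-coloring of $G$ is a function $\phi:E(G)\to\{1,2,\ldots,k\}$ such that any two incident edges (edges sharing an end vertex) receive different colors. For an edge coloring $\phi$ and a vertex $v$, $C_\phi(v)$ denotes the set of colors assigned by $\phi$ to the edges incident to $v$. The coloring $\phi$ is an adjacent vertex distinguishing edge coloring if $C_\phi(u)\neq C_\phi(v)$ for every pair of adjacent vertices $u,v$. For a normal graph $G$, the adjacent vertex distinguishing chromatic index $\chi'_a(G)$ is the smallest integer $k$ such that $G$ has an adjacent vertex distinguishing edge $k$-coloring. -}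

module Defs where

open import Data.Fin using (Fin; _<_)
open import Data.Fin.Subset using (Subset; ∣_∣)
open import Data.List using (map; allFin)
open import Data.List.Extrema.Nat using (max)
open import Data.Nat as ℕ using (ℕ)
open import Data.Product using (Σ; ∃-syntax; _×_)
open import Data.Sum using (_⊎_)
open import Data.Vec using (tabulate)
open import Level using (0ℓ)
open import Relation.Binary using (Rel; Decidable; Symmetric; Irreflexive)
open import Relation.Binary.PropositionalEquality using (_≡_; _≢_)
open import Relation.Nullary using (¬_; does)
open import Relation.Unary using (Pred; _≐_)

record Graph : Set₁ where
  field
    order   : ℕ
    _~_     : Rel (Fin order) 0ℓ
    _~?_    : Decidable _~_
    ~-sym   : Symmetric _~_
    ~-irrefl : Irreflexive _≡_ _~_

  Vertex : Set
  Vertex = Fin order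

  -- Each unordered edge {u , v} is represented once, by listing its smaller
  -- end first; the proof fields are irrelevant, so an edge is determined by
  -- its two ends.
  record Edge : Set where
    constructor edge
    field
      lower upper : Vertex
      .ordered    : lower < upper
      .adjacent   : lower ~ upper

  open Edge public

  Incident : Vertex → Edge → Set
  Incident v e = (v ≡ lower e) ⊎ (v ≡ upper e)

  neighbourhood : Vertex → Subset order
  neighbourhood v = tabulate (λ w → does (v ~? w))

  degree : Vertex → ℕ
  degree v = ∣ neighbourhood v ∣

  -- The leading 0 is only the value for the graph with no vertices.
  Δ : ℕ
  Δ = max 0 (map degree (allFin order))

  NoIsolatedVertices : Set
  NoIsolatedVertices = ∀ v → degree v ≢ 0

  IsolatedEdge : Edge → Set
  IsolatedEdge e = degree (lower e) ≡ 1 × degree (upper e) ≡ 1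

  Normal : Set
  Normal = ∀ e → ¬ IsolatedEdge e

  -- The colours 1 , … , k are the elements of Fin k.
  ProperEdgeColouring : (k : ℕ) → (Edge → Fin k) → Set
  ProperEdgeColouring k φ =
    ∀ v e f → e ≢ f → Incident v e → Incident v f → φ e ≢ φ f

  C : ∀ {k} → (Edge → Fin k) → Vertex → Pred (Fin k) 0ℓ
  C φ v c = ∃[ e ] (Incident v e × φ e ≡ c)

  AdjacentVertexDistinguishing : (k : ℕ) → (Edge → Fin k) → Set
  AdjacentVertexDistinguishing k φ =
    ProperEdgeColouring k φ × (∀ u v → u ~ v → ¬ (C φ u ≐ C φ v))

  AVDColourable : ℕ → Set
  AVDColourable k = Σ (Edge → Fin k) (AdjacentVertexDistinguishing k)

  -- k = χ′ₐ(G).  This is a relation rather than a function because a graph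
  -- with an isolated edge has no such k.
  IsAVDChromaticIndex : ℕ → Set
  IsAVDChromaticIndex k =
    AVDColourable k × (∀ j → AVDColourable j → k ℕ.≤ j)

{-# OPTIONS --safe #-}

-- Properly colour all edges with k = ⌊3Δ/2⌋ + 1 colours (Shannon's bound, by
-- Kempe chains), and then recolour the edges of a spanning forest with Δ + 2
-- new colours so that already the sets of new colours distinguish adjacent
-- vertices; in total 2 (k + Δ + 2) ≤ 5 (Δ + 2).
--
-- The forest is that of a depth-first search, so a vertex without children is
-- adjacent to earlier vertices only.  Its edges are coloured from the roots
-- down.  When the last edge from p to its children is coloured, the sets of
-- the earlier neighbours of p are final; each of them excludes at most one
-- colour, as does each child of p, so at most deg p ≤ Δ colours are excluded.
-- A childless vertex sees one new colour, while an adjacent vertex, having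
-- children, sees two unless it is a root with a single child.  That case is
-- settled by a colour reserved for one edge at each root, since G is normal.
module Submission where

open import Defs
open import Data.Empty using (⊥)
open import Data.Fin as Fin
  using (Fin; zero; suc; toℕ; fromℕ<; _≟_; _↑ˡ_; _↑ʳ_; splitAt; combine; remQuot; finToFun; funToFin)
open import Data.Fin.Permutation.Components using (transpose)
open import Data.Fin.Properties as Fin
  using (any?; all?; splitAt-↑ˡ; splitAt-↑ʳ; ↑ˡ-injective; ↑ʳ-injective; remQuot-combine; finToFun-funToFin)
open import Data.Fin.Subset using (Subset; ∣_∣; _∈_; inside; outside; ⊤; _-_; ⁅_⁆)
open import Data.Fin.Subset.Properties
  using (∣⊤∣≡n; x∈p∧x≢y⇒x∈p-y; x∈p⇒∣p-x∣<∣p∣; ∣p∣≤∣x∷p∣; ⊆-antisym; ∣⁅x⁆∣≡1; x∈⁅x⁆; x∈⁅y⁆⇒x≡y)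
open import Data.Integer using (+_)
import Data.Integer as ℤ
import Data.Integer.Properties as ℤ
open import Data.List as List using (List; []; _∷_; allFin; cartesianProduct)
open import Data.List.Extrema.Nat using (max; xs≤max)
open import Data.List.Membership.Propositional as List using ()
open import Data.List.Membership.Propositional.Properties using (∈-cartesianProduct⁺; ∈-allFin)
import Data.List.Relation.Unary.All as All
import Data.List.Relation.Unary.All.Properties as All
open import Data.List.Relation.Unary.Any using (here; there)
open import Data.Maybe using (Maybe; just; nothing; fromMaybe)
open import Data.Maybe.Properties as Maybe using (just-injective)
open import Data.Nat as ℕ using (ℕ; zero; suc; z≤n; s≤s; _+_; ⌈_/2⌉; ⌊_/2⌋)
open import Data.Nat.Properties as ℕ hiding (_≟_)
open import Data.Nat.Solver using (module +-*-Solver)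
open import Data.Product using (Σ; ∃-syntax; _×_; _,_; proj₁; proj₂; map₂)
open import Data.Rational using (_/_; _*_; _≤_; toℚᵘ)
open import Data.Rational.Properties using (toℚᵘ-cancel-≤; toℚᵘ-fromℚᵘ; toℚᵘ-homo-*)
open import Data.Rational.Unnormalised using (mkℚᵘ; *≤*)
import Data.Rational.Unnormalised as ℚᵘ
import Data.Rational.Unnormalised.Properties as ℚᵘ
open import Data.Sum using (_⊎_; inj₁; inj₂; [_,_]′)
open import Data.Unit using (tt)
open import Data.Vec using ([]; _∷_; here; there; tabulate)
open import Data.Vec.Functional using (updateAt)
open import Data.Vec.Functional.Properties using (updateAt-updates; updateAt-minimal)
open import Data.Vec.Properties using ([]=⇒lookup; lookup⇒[]=; lookup∘tabulate)
open import Function using (_∘_; const; id)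
open import Relation.Binary using (tri<; tri≈; tri>)
open import Relation.Binary.PropositionalEquality
open import Relation.Nullary using (¬_; Dec; yes; no; does; ¬?; contradiction; recompute)
open import Relation.Nullary.Decidable
  using (decidable-stable; dec-true; dec-false; map′; _×-dec_; _⊎-dec_; _→-dec_)
open import Relation.Unary using (Decidable; _⊆_; _≐_)

-- The coefficient 5/2 is 3/2 from Shannon's bound plus 1 from the forest. In a forest every edge
-- has one upper end, so each vertex with children owns an edge, the last one down, with which to
-- differ from all its earlier neighbours at once; an adjacent pair is thus the duty of its later
-- vertex, unless that vertex is childless. The budget is tight at the parent of `p`, which forbids
-- twice: the colour of its edge to `p`, and the colour that would complete its set. The child whose
-- edge is being coloured forbids nothing on its own account, so its share pays for the second. That
-- the index exists as a minimum takes more, constructively, than an upper bound: colourability with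
-- a given number of colours is shown decidable, and the least such number is found by search.

-- Finite search, counting and greedy choice

least : ∀ {P : ℕ → Set} → Decidable P → ∀ n → P n →
        ∃[ m ] (P m × (∀ j → P j → m ℕ.≤ j))
least P? zero    p₀ = zero , p₀ , λ _ _ → z≤n
least P? (suc n) pₙ with P? zero
... | yes p₀ = zero , p₀ , λ _ _ → z≤n
... | no ¬p₀ with least (P? ∘ suc) n pₙ
...   | m , pₘ , min = suc m , pₘ , λ where
        zero    p → contradiction p ¬p₀
        (suc j) p → s≤s (min j p)

greatest : ∀ {n} {P : Fin n → Set} → Decidable P → ∃[ i ] P i →
           ∃[ i ] (P i × (∀ j → P j → j Fin.≤ i))
greatest {suc n} P? (i , pᵢ) with any? (P? ∘ suc)
... | yes q with greatest (P? ∘ suc) q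
...   | k , pₖ , max = suc k , pₖ , λ where
        zero    _ → z≤n
        (suc j) p → s≤s (max j p)
greatest {suc n} P? (zero , p₀)  | no ¬q = zero , p₀ , λ where
        zero    _ → z≤n
        (suc j) p → contradiction (j , p) ¬q
greatest {suc n} P? (suc i , pᵢ) | no ¬q = contradiction (i , pᵢ) ¬q

injection⇒∣p∣≤∣q∣ : ∀ {m n} (p : Subset m) (q : Subset n) (f : Fin m → Fin n) →
  (∀ {i} → i ∈ p → f i ∈ q) →
  (∀ {i j} → i ∈ p → j ∈ p → f i ≡ f j → i ≡ j) → ∣ p ∣ ℕ.≤ ∣ q ∣
injection⇒∣p∣≤∣q∣ []            q f into inj = z≤n
injection⇒∣p∣≤∣q∣ (outside ∷ p) q f into inj =
  injection⇒∣p∣≤∣q∣ p q (f ∘ suc) (into ∘ there)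
    (λ i∈p j∈p eq → Fin.suc-injective (inj (there i∈p) (there j∈p) eq))
injection⇒∣p∣≤∣q∣ (inside ∷ p)  q f into inj =
  ≤-trans (s≤s (injection⇒∣p∣≤∣q∣ p (q - f zero) (f ∘ suc)
    (λ i∈p → x∈p∧x≢y⇒x∈p-y (into (there i∈p))
                (λ eq → Fin.0≢1+n (inj here (there i∈p) (sym eq))))
    (λ i∈p j∈p eq → Fin.suc-injective (inj (there i∈p) (there j∈p) eq))))
  (x∈p⇒∣p-x∣<∣p∣ (into here))

-- Were every `a` killed, choosing a killer for each would inject `Fin m` into `q`, since one `y`
-- kills at most one `a`.
escape : ∀ {m n} {K : Fin n → Fin m → Set} → (∀ y a → Dec (K y a)) →
  (q : Subset n) → (∀ {y a} → K y a → y ∈ q) →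
  (∀ {y a b} → K y a → K y b → a ≡ b) → ∣ q ∣ ℕ.< m → ∃[ a ] (∀ y → ¬ K y a)
escape {m} {n} {K} K? q K⊆q functional ∣q∣<m
  with any? (λ a → all? (λ y → ¬? (K? y a)))
... | yes found = found
... | no ¬found = contradiction ∣q∣<m (≤⇒≯ m≤∣q∣)
  where
  killer : ∀ a → ∃[ y ] K y a
  killer a = decidable-stable (any? (λ y → K? y a))
    (λ none → ¬found (a , λ y k → none (y , k)))
  m≤∣q∣ : m ℕ.≤ ∣ q ∣
  m≤∣q∣ = subst (ℕ._≤ ∣ q ∣) (∣⊤∣≡n m)
    (injection⇒∣p∣≤∣q∣ ⊤ q (proj₁ ∘ killer) (λ {a} _ → K⊆q (proj₂ (killer a)))
      (λ {a} {b} _ _ eq → functional (proj₂ (killer a))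
                            (subst (λ y → K y b) (sym eq) (proj₂ (killer b)))))

-- Double counting: each `i` contributes at least two on the right. For the colours used at three
-- vertices this yields 2k ≤ 3Δ.
two-of-three : ∀ {n} (p q r : Subset n) →
  (∀ i → (i ∈ p × i ∈ q) ⊎ (i ∈ p × i ∈ r) ⊎ (i ∈ q × i ∈ r)) →
  n + n ℕ.≤ ∣ p ∣ + (∣ q ∣ + ∣ r ∣)
two-of-three []      []      []      two = z≤n
two-of-three {suc n} (x ∷ p) (y ∷ q) (z ∷ r) two = begin
  suc (n + suc n)                             ≡⟨ cong suc (+-suc n n) ⟩
  2 + (n + n)                                 ≤⟨ +-monoʳ-≤ 2 (two-of-three p q r (drop ∘ two ∘ suc)) ⟩
  2 + (∣ p ∣ + (∣ q ∣ + ∣ r ∣))               ≤⟨ count (two zero) ⟩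
  ∣ x ∷ p ∣ + (∣ y ∷ q ∣ + ∣ z ∷ r ∣)         ∎
  where
  open ≤-Reasoning
  drop : ∀ {i} →
    (suc i ∈ x ∷ p × suc i ∈ y ∷ q) ⊎ (suc i ∈ x ∷ p × suc i ∈ z ∷ r) ⊎ (suc i ∈ y ∷ q × suc i ∈ z ∷ r) →
    (i ∈ p × i ∈ q) ⊎ (i ∈ p × i ∈ r) ⊎ (i ∈ q × i ∈ r)
  drop (inj₁ (there a , there b))        = inj₁ (a , b)
  drop (inj₂ (inj₁ (there a , there b))) = inj₂ (inj₁ (a , b))
  drop (inj₂ (inj₂ (there a , there b))) = inj₂ (inj₂ (a , b))
  count : (zero ∈ x ∷ p × zero ∈ y ∷ q) ⊎ (zero ∈ x ∷ p × zero ∈ z ∷ r) ⊎ (zero ∈ y ∷ q × zero ∈ z ∷ r) →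
    2 + (∣ p ∣ + (∣ q ∣ + ∣ r ∣)) ℕ.≤ ∣ x ∷ p ∣ + (∣ y ∷ q ∣ + ∣ z ∷ r ∣)
  count (inj₁ (here , here)) = s≤s (≤-trans (≤-reflexive (sym (+-suc ∣ p ∣ _)))
    (+-monoʳ-≤ ∣ p ∣ (s≤s (+-monoʳ-≤ ∣ q ∣ (∣p∣≤∣x∷p∣ z r)))))
  count (inj₂ (inj₁ (here , here))) = s≤s (≤-trans (≤-reflexive
    (trans (sym (+-suc ∣ p ∣ _)) (cong (∣ p ∣ ℕ.+_) (sym (+-suc ∣ q ∣ ∣ r ∣)))))
    (+-monoʳ-≤ ∣ p ∣ (+-monoˡ-≤ (suc ∣ r ∣) (∣p∣≤∣x∷p∣ y q))))
  count (inj₂ (inj₂ (here , here))) = ≤-trans (≤-reflexive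
    (trans (cong suc (sym (+-suc ∣ p ∣ _))) (trans (sym (+-suc ∣ p ∣ _))
      (cong (λ m → ∣ p ∣ + suc m) (sym (+-suc ∣ q ∣ ∣ r ∣))))))
    (+-monoˡ-≤ _ (∣p∣≤∣x∷p∣ x p))

-- Values are fixed by increasing `κ`. By `local`, whether `i` is good depends on keys up to its own
-- only, so later updates cannot spoil it.
greedy : ∀ {n} {A : Set} (κ : Fin n → ℕ) → (∀ {i j} → κ i ≡ κ j → i ≡ j) →
  (Good : Fin n → (Fin n → A) → Set) →
  (∀ i {ψ ψ′} → (∀ j → κ j ℕ.≤ κ i → ψ j ≡ ψ′ j) → Good i ψ → Good i ψ′) →
  (∀ i ψ → ∃[ a ] Good i (updateAt ψ i (const a))) →
  (Fin n → A) → ∀ t → ∃[ ψ ] (∀ i → κ i ℕ.< t → Good i ψ)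
greedy κ κ-inj Good local step ψ₀ zero    = ψ₀ , λ _ ()
greedy κ κ-inj Good local step ψ₀ (suc t)
  with greedy κ κ-inj Good local step ψ₀ t | any? (λ i → κ i ℕ.≟ t)
... | ψ , good | no none = ψ , λ i κi≤t →
  good i (≤∧≢⇒< (≤-pred κi≤t) (λ eq → none (i , eq)))
... | ψ , good | yes (i , refl) with step i ψ
...   | a , goodᵢ = updateAt ψ i (const a) , extended
  where
  extended : ∀ j → κ j ℕ.< suc (κ i) → Good j (updateAt ψ i (const a))
  extended j κj≤κi with j ≟ i
  ... | yes refl = goodᵢ
  ... | no j≢i   = local j
    (λ k κk≤κj → sym (updateAt-minimal k i ψ
      (λ k≡i → j≢i (κ-inj (≤-antisym (≤-pred κj≤κi) (subst (ℕ._≤ κ j) (cong κ k≡i) κk≤κj))))))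
    (good j (≤∧≢⇒< (≤-pred κj≤κi) (λ eq → j≢i (κ-inj eq))))

-- Kempe chains as orbits of two involutions

module Alternating {n} (p q : Fin n → Fin n)
  (p-inv : ∀ x → p (p x) ≡ x) (q-inv : ∀ x → q (q x) ≡ x)
  (u : Fin n) (pu≡u : p u ≡ u) where

  -- Joined along `p` and `q`, the points form paths and cycles, and `u` ends a path. Iterating
  -- `q ∘ p` from `u` takes every second vertex outwards, turns at the far end and takes the others
  -- on the way back, so the orbit is the whole path.
  orbit : ℕ → Fin n
  orbit zero    = u
  orbit (suc i) = q (p (orbit i))

  step-back : ∀ {x y} → q (p x) ≡ q (p y) → x ≡ y
  step-back {x} {y} eq = begin
    x             ≡⟨ p-inv x ⟨
    p (p x)       ≡⟨ cong p (q-inv (p x)) ⟨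
    p (q (q (p x))) ≡⟨ cong (p ∘ q) eq ⟩
    p (q (q (p y))) ≡⟨ cong p (q-inv (p y)) ⟩
    p (p y)       ≡⟨ p-inv y ⟩
    y             ∎
    where open ≡-Reasoning

  orbit-shift : ∀ i j → orbit (i + j) ≡ orbit i → orbit j ≡ u
  orbit-shift zero    j eq = eq
  orbit-shift (suc i) j eq = orbit-shift i j (step-back eq)

  returns : ∃[ d ] orbit (suc d) ≡ u
  returns with Fin.pigeonhole (n<1+n n) (λ (i : Fin (suc n)) → orbit (toℕ i))
  ... | i , j , i<j , eq with m≤n⇒∃[o]m+o≡n i<j
  ...   | d , i+d≡j = d , orbit-shift (toℕ i) (suc d)
    (trans (cong orbit (trans (+-suc (toℕ i) d) i+d≡j)) (sym eq))

  abstract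
    least-return : ∃[ d ] (orbit (suc d) ≡ u × (∀ j → orbit (suc j) ≡ u → d ℕ.≤ j))
    least-return = least (λ d → orbit (suc d) ≟ u) (proj₁ returns) (proj₂ returns)

  period : ℕ
  period = suc (proj₁ least-return)

  orbit-period : orbit period ≡ u
  orbit-period = proj₁ (proj₂ least-return)

  orbit-distinct : ∀ {i j} → i ℕ.< j → j ℕ.< period → orbit i ≢ orbit j
  orbit-distinct {i} {j} i<j j<N eq with m≤n⇒∃[o]m+o≡n i<j
  ... | d , i+d≡j = <⇒≱ (≤-trans (s≤s (m≤n+m d i)) (≤-trans (≤-reflexive i+d≡j) (≤-pred j<N)))
    (proj₂ (proj₂ least-return) d (orbit-shift i (suc d)
      (trans (cong orbit (trans (+-suc i d) i+d≡j)) (sym eq))))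

  orbit-injective : ∀ {i j} → i ℕ.< period → j ℕ.< period → orbit i ≡ orbit j → i ≡ j
  orbit-injective {i} {j} i<N j<N eq with <-cmp i j
  ... | tri< i<j _ _ = contradiction eq (orbit-distinct i<j j<N)
  ... | tri≈ _ i≡j _ = i≡j
  ... | tri> _ _ j<i = contradiction (sym eq) (orbit-distinct j<i i<N)

  -- The involution `p` conjugates `q ∘ p` to its inverse and fixes `u`, so it acts on the cyclic
  -- orbit as the reflection through `u`.
  p-orbit : ∀ i j → i + j ≡ period → p (orbit i) ≡ orbit j
  p-orbit zero    j refl = trans pu≡u (sym orbit-period)
  p-orbit (suc i) j eq   = begin
    p (q (p (orbit i)))     ≡⟨ cong (p ∘ q) (p-orbit i (suc j) (trans (+-suc i j) eq)) ⟩
    p (q (q (p (orbit j)))) ≡⟨ cong p (q-inv _) ⟩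
    p (p (orbit j))         ≡⟨ p-inv _ ⟩
    orbit j                 ∎
    where open ≡-Reasoning

  q-orbit : ∀ i j → i + j ≡ period → q (orbit i) ≡ orbit (suc j)
  q-orbit i j eq = trans (cong q (sym (p-inv _))) (cong (q ∘ p) (p-orbit i j eq))

  -- Indices run up to `period` inclusive, naming `u` twice, so that the reflection by `p` stays
  -- within range at index 0.
  Chain : Fin n → Set
  Chain x = ∃[ i ] orbit (toℕ {suc period} i) ≡ x

  chain? : Decidable Chain
  chain? x = any? (λ i → orbit (toℕ i) ≟ x)

  orbit-chain : ∀ {i} → i ℕ.≤ period → Chain (orbit i)
  orbit-chain i≤N = fromℕ< (s≤s i≤N) , cong orbit (Fin.toℕ-fromℕ< (s≤s i≤N))

  chain-start : Chain u
  chain-start = zero , refl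

  p-chain : ∀ {x} → Chain x → Chain (p x)
  p-chain (i , refl) = subst Chain (sym (p-orbit (toℕ i) _ (m+[n∸m]≡n (Fin.toℕ≤pred[n] i))))
    (orbit-chain (m∸n≤m period (toℕ i)))

  q-chain : ∀ {x} → Chain x → Chain (q x)
  q-chain (zero  , refl) = subst Chain (cong q pu≡u) (orbit-chain (s≤s z≤n))
  q-chain (suc i , refl) =
    subst Chain (sym (q-orbit (suc (toℕ i)) _ (m+[n∸m]≡n (Fin.toℕ≤pred[n] (suc i)))))
      (orbit-chain (s≤s (m∸n≤m _ (toℕ i))))

  -- The maps p and q reflect the index i to N − i and N − i + 1, N being the
  -- period, so a fixed point orbit i with 0 < i < N has 2 i ∈ {N , N + 1}.
  chain-end : ∀ {v} → Chain v → v ≢ u → p v ≡ v ⊎ q v ≡ v → v ≡ orbit ⌈ period /2⌉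
  chain-end (zero  , refl) v≢u fixed = contradiction refl v≢u
  chain-end (suc i , refl) v≢u fixed with m≤n⇒∃[o]m+o≡n (Fin.toℕ≤pred[n] (suc i))
  ... | zero  , eq = contradiction
    (trans (cong orbit (trans (sym (+-identityʳ _)) eq)) orbit-period) v≢u
  ... | suc j , eq = cong orbit (end fixed)
    where
    i+1<N : suc (toℕ i) ℕ.< period
    i+1<N = subst (suc (toℕ i) ℕ.<_) eq (m<m+n (suc (toℕ i)) (s≤s z≤n))
    j+1<N : suc j ℕ.< period
    j+1<N = subst (suc j ℕ.<_) eq (m<n+m (suc j) (s≤s z≤n))
    end : p (orbit (suc (toℕ i))) ≡ _ ⊎ q (orbit (suc (toℕ i))) ≡ _ →
          suc (toℕ i) ≡ ⌈ period /2⌉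
    end (inj₁ pv≡v) with orbit-injective i+1<N j+1<N (trans (sym pv≡v) (p-orbit (suc (toℕ i)) (suc j) eq))
    ... | refl = trans (n≡⌈n+n/2⌉ (suc j)) (cong ⌈_/2⌉ eq)
    -- Injectivity holds below the period only. A reflected index equal to the period would name
    -- `u`, and `v` is not `u`.
    end (inj₂ qv≡v) with suc (suc j) ℕ.≟ period
    ... | yes j+2≡N = contradiction
      (trans (trans (sym qv≡v) (q-orbit (suc (toℕ i)) (suc j) eq)) (trans (cong orbit j+2≡N) orbit-period)) v≢u
    ... | no j+2≢N with orbit-injective i+1<N (≤∧≢⇒< j+1<N j+2≢N)
                          (trans (sym qv≡v) (q-orbit (suc (toℕ i)) (suc j) eq))
    -- Here twice the index is N + 1, and ⌈N/2⌉ is by definition ⌊(N + 1)/2⌋, so one formula locates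
    -- the far end for both parities.
    ...   | i+1≡j+2 = trans (n≡⌊n+n/2⌋ (suc (toℕ i))) (cong ⌊_/2⌋
      (trans (cong (suc (toℕ i) ℕ.+_) i+1≡j+2) (trans (+-suc (suc (toℕ i)) (suc j)) (cong suc eq))))

-- Decidable subsets, transpositions and degrees

⟪_⟫ : ∀ {n} {P : Fin n → Set} → Decidable P → Subset n
⟪ P? ⟫ = tabulate (λ i → does (P? i))

∈⟪⟫⁺ : ∀ {n} {P : Fin n → Set} (P? : Decidable P) {i} → P i → i ∈ ⟪ P? ⟫
∈⟪⟫⁺ P? {i} p = lookup⇒[]= i _ (trans (lookup∘tabulate _ i) (dec-true (P? i) p))

∈⟪⟫⁻ : ∀ {n} {P : Fin n → Set} (P? : Decidable P) {i} → i ∈ ⟪ P? ⟫ → P i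
∈⟪⟫⁻ P? {i} i∈ with P? i | trans (sym (lookup∘tabulate (λ i → does (P? i)) i)) ([]=⇒lookup i∈)
... | yes p | _ = p

transposeˡ : ∀ {n} (a b : Fin n) → transpose a b a ≡ b
transposeˡ a b rewrite dec-true (a ≟ a) refl = refl

transposeʳ : ∀ {n} (a b : Fin n) → transpose a b b ≡ a
transposeʳ a b with b ≟ a
... | yes refl = refl
... | no  _ rewrite dec-true (b ≟ b) refl = refl

transpose-other : ∀ {n} {a b c : Fin n} → c ≢ a → c ≢ b → transpose a b c ≡ c
transpose-other {a = a} {b} {c} c≢a c≢b
  rewrite dec-false (c ≟ a) c≢a | dec-false (c ≟ b) c≢b = refl

transpose-involutive : ∀ {n} (a b c : Fin n) → transpose a b (transpose a b c) ≡ c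
transpose-involutive a b c with c ≟ a
... | yes refl = transposeʳ a b
... | no c≢a with c ≟ b
...   | yes refl = transposeˡ a b
...   | no c≢b   = transpose-other c≢a c≢b

module GraphProperties (G : Graph) where
  open Graph G

  ∈neighbourhood⁺ : ∀ {v w} → v ~ w → w ∈ neighbourhood v
  ∈neighbourhood⁺ {v} = ∈⟪⟫⁺ (v ~?_)

  ∈neighbourhood⁻ : ∀ {v w} → w ∈ neighbourhood v → v ~ w
  ∈neighbourhood⁻ {v} = ∈⟪⟫⁻ (v ~?_)

  degree≤Δ : ∀ v → degree v ℕ.≤ Δ
  degree≤Δ v = All.lookup (All.map⁻ (xs≤max 0 (List.map degree (allFin order)))) (∈-allFin v)

-- Shannon's bound on proper edge colourings

module Shannon (G : Graph) (k : ℕ) (3Δ<2k : Graph.Δ G + (Graph.Δ G + Graph.Δ G) ℕ.< k + k) where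
  open Graph G
  open GraphProperties G

  -- A partial proper edge colouring: mate a x is the other end of the edge of
  -- colour a at x, or x itself if there is no such edge.
  record Partial : Set where
    field
      mate      : Fin k → Vertex → Vertex
      mate-inv  : ∀ a x → mate a (mate a x) ≡ x
      mate-~    : ∀ {a x} → mate a x ≢ x → x ~ mate a x
      mate-uniq : ∀ {a b x} → mate a x ≡ mate b x → mate a x ≢ x → a ≡ b

    Covers : Vertex → Vertex → Set
    Covers x y = ∃[ a ] mate a x ≡ y

    Free : Vertex → Fin k → Set
    Free x a = mate a x ≡ x

    covers? : ∀ x y → Dec (Covers x y)
    covers? x y = any? (λ a → mate a x ≟ y)

    mate-sym : ∀ {a x y} → mate a x ≡ y → mate a y ≡ x
    mate-sym refl = mate-inv _ _

    mate-injective : ∀ {a x y} → mate a x ≡ mate a y → x ≡ y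
    mate-injective eq = trans (sym (mate-inv _ _)) (mate-sym (sym eq))

    covers-sym : ∀ {x y} → Covers x y → Covers y x
    covers-sym (a , eq) = a , mate-sym eq

    used : Vertex → Subset k
    used x = ⟪ (λ a → ¬? (mate a x ≟ x)) ⟫

    free⊎used : ∀ x a → Free x a ⊎ a ∈ used x
    free⊎used x a with mate a x ≟ x
    ... | yes free  = inj₁ free
    ... | no ¬free = inj₂ (∈⟪⟫⁺ (λ a → ¬? (mate a x ≟ x)) ¬free)

    ∣used∣≤Δ : ∀ x → ∣ used x ∣ ℕ.≤ Δ
    ∣used∣≤Δ x = ≤-trans
      (injection⇒∣p∣≤∣q∣ (used x) (neighbourhood x) (λ a → mate a x)
        (λ a∈ → ∈neighbourhood⁺ (mate-~ (∈⟪⟫⁻ (λ a → ¬? (mate a x ≟ x)) a∈)))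
        (λ a∈ _ eq → mate-uniq eq (∈⟪⟫⁻ (λ a → ¬? (mate a x ≟ x)) a∈)))
      (degree≤Δ x)

    free-colour : ∀ x → ∃[ a ] Free x a
    free-colour x with any? (λ a → mate a x ≟ x)
    ... | yes found = found
    ... | no ¬found = contradiction 3Δ<2k (≤⇒≯ (≤-trans
      -- The same count serves with `x` taken three times: a colour used at `x` is then used at all
      -- three.
      (two-of-three (used x) (used x) (used x) (λ a → inj₁ (always a , always a)))
      (+-mono-≤ (∣used∣≤Δ x) (+-mono-≤ (∣used∣≤Δ x) (∣used∣≤Δ x)))))
      where
      always : ∀ a → a ∈ used x
      always a = [ (λ free → contradiction (a , free) ¬found) , id ]′ (free⊎used x a)

    CommonFree : Vertex → Vertex → Set
    CommonFree x y = ∃[ a ] (Free x a × Free y a)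

    commonFree? : ∀ x y → Dec (CommonFree x y)
    commonFree? x y = any? (λ a → (mate a x ≟ x) ×-dec (mate a y ≟ y))

    -- If no two of the vertices share a free colour, every colour is used at two of them at least,
    -- hence 2k ≤ 3Δ. This is where the 3/2 arises.
    common-free : ∀ x y z → CommonFree x y ⊎ CommonFree x z ⊎ CommonFree y z
    common-free x y z with commonFree? x y | commonFree? x z | commonFree? y z
    ... | yes xy | _      | _      = inj₁ xy
    ... | no _   | yes xz | _      = inj₂ (inj₁ xz)
    ... | no _   | no _   | yes yz = inj₂ (inj₂ yz)
    ... | no ¬xy | no ¬xz | no ¬yz = contradiction 3Δ<2k (≤⇒≯ (≤-trans
      (two-of-three (used x) (used y) (used z) twice)
      (+-mono-≤ (∣used∣≤Δ x) (+-mono-≤ (∣used∣≤Δ y) (∣used∣≤Δ z)))))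
      where
      twice : ∀ a → (a ∈ used x × a ∈ used y) ⊎ (a ∈ used x × a ∈ used z) ⊎ (a ∈ used y × a ∈ used z)
      twice a with free⊎used x a | free⊎used y a | free⊎used z a
      ... | inj₂ ux | inj₂ uy | _       = inj₁ (ux , uy)
      ... | inj₂ ux | inj₁ _  | inj₂ uz = inj₂ (inj₁ (ux , uz))
      ... | inj₁ _  | inj₂ uy | inj₂ uz = inj₂ (inj₂ (uy , uz))
      ... | inj₁ fx | inj₁ fy | _       = contradiction (a , fx , fy) ¬xy
      ... | inj₁ fx | inj₂ _  | inj₁ fz = contradiction (a , fx , fz) ¬xz
      ... | inj₂ _  | inj₁ fy | inj₁ fz = contradiction (a , fy , fz) ¬yz

  open Partial

  empty : Partial
  empty = record
    { mate      = λ _ x → x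
    ; mate-inv  = λ _ _ → refl
    ; mate-~    = λ moved → contradiction refl moved
    ; mate-uniq = λ _ moved → contradiction refl moved
    }

  module Colour (m : Partial) (a : Fin k) {u v} (u~v : u ~ v)
    (freeᵤ : Free m u a) (freeᵥ : Free m v a) (¬uv : ¬ Covers m u v) where

    mate′ : Fin k → Vertex → Vertex
    mate′ c x with c ≟ a
    ... | no _  = mate m c x
    ... | yes _ with x ≟ u | x ≟ v
    ...   | yes _ | _     = v
    ...   | no _  | yes _ = u
    ...   | no _  | no _  = mate m a x

    mate′-other : ∀ {c} x → c ≢ a → mate′ c x ≡ mate m c x
    mate′-other {c} x c≢a with c ≟ a
    ... | yes c≡a = contradiction c≡a c≢a
    ... | no _    = refl

    mate′-u : mate′ a u ≡ v
    mate′-u with a ≟ a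
    ... | no a≢a = contradiction refl a≢a
    ... | yes _ with u ≟ u | u ≟ v
    ...   | yes _   | _ = refl
    ...   | no u≢u  | _ = contradiction refl u≢u

    mate′-v : mate′ a v ≡ u
    mate′-v with a ≟ a
    ... | no a≢a = contradiction refl a≢a
    ... | yes _ with v ≟ u | v ≟ v
    ...   | yes v≡u | _      = v≡u
    ...   | no _    | yes _  = refl
    ...   | no _    | no v≢v = contradiction refl v≢v

    mate′-else : ∀ {x} → x ≢ u → x ≢ v → mate′ a x ≡ mate m a x
    mate′-else {x} x≢u x≢v with a ≟ a
    ... | no a≢a = contradiction refl a≢a
    ... | yes _ with x ≟ u | x ≟ v
    ...   | yes x≡u | _       = contradiction x≡u x≢u
    ...   | no _    | yes x≡v = contradiction x≡v x≢v
    ...   | no _    | no _    = refl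

    data View : Fin k → Vertex → Set where
      other : ∀ {c} x → c ≢ a → View c x
      at-u  : View a u
      at-v  : View a v
      else  : ∀ {x} → x ≢ u → x ≢ v → View a x

    view : ∀ c x → View c x
    view c x with c ≟ a
    ... | no c≢a = other x c≢a
    ... | yes refl with x ≟ u | x ≟ v
    ...   | yes refl | _        = at-u
    ...   | no _     | yes refl = at-v
    ...   | no x≢u   | no x≢v   = else x≢u x≢v

    inv : ∀ c x → mate′ c (mate′ c x) ≡ x
    inv c x with view c x
    ... | other x c≢a = trans (cong (mate′ c) (mate′-other x c≢a))
                          (trans (mate′-other _ c≢a) (mate-inv m c x))
    ... | at-u = trans (cong (mate′ a) mate′-u) mate′-v
    ... | at-v = trans (cong (mate′ a) mate′-v) mate′-u
    ... | else x≢u x≢v = trans (cong (mate′ a) (mate′-else x≢u x≢v)) (trans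
      (mate′-else (λ eq → x≢u (trans (sym (mate-sym m eq)) freeᵤ))
                  (λ eq → x≢v (trans (sym (mate-sym m eq)) freeᵥ)))
      (mate-inv m a x))

    adj : ∀ {c x} → mate′ c x ≢ x → x ~ mate′ c x
    adj {c} {x} moved with view c x
    ... | other x c≢a  = subst (x ~_) (sym (mate′-other {c} x c≢a))
                           (mate-~ m (moved ∘ trans (mate′-other {c} x c≢a)))
    ... | at-u         = subst (u ~_) (sym mate′-u) u~v
    ... | at-v         = subst (v ~_) (sym mate′-v) (~-sym u~v)
    ... | else x≢u x≢v = subst (x ~_) (sym (mate′-else x≢u x≢v))
                           (mate-~ m (moved ∘ trans (mate′-else x≢u x≢v)))

    -- At an end of the new edge, a second colour leading to the same neighbour would mean that `u`
    -- and `v` were covered before.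
    fresh : ∀ {c x} → c ≢ a → mate′ a x ≢ x → mate′ c x ≢ mate′ a x
    fresh {c} {x} c≢a moved eq with view a x
    ... | other _ a≢a  = a≢a refl
    ... | at-u         = ¬uv (c , trans (sym (mate′-other u c≢a)) (trans eq mate′-u))
    ... | at-v         = ¬uv (c , mate-sym m (trans (sym (mate′-other v c≢a)) (trans eq mate′-v)))
    ... | else x≢u x≢v = c≢a (mate-uniq m old (λ fixed → moved (trans (sym eq) (trans (mate′-other {c} x c≢a) fixed))))
      where
      old : mate m c x ≡ mate m a x
      old = trans (sym (mate′-other x c≢a)) (trans eq (mate′-else x≢u x≢v))

    uniq : ∀ {c d x} → mate′ c x ≡ mate′ d x → mate′ c x ≢ x → c ≡ d
    uniq {c} {d} {x} eq moved = helper (c ≟ a) (d ≟ a)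
      where
      helper : Dec (c ≡ a) → Dec (d ≡ a) → c ≡ d
      helper (yes c≡a)  (yes d≡a) = trans c≡a (sym d≡a)
      helper (yes refl) (no d≢a)  = contradiction (sym eq) (fresh d≢a moved)
      helper (no c≢a)   (yes refl) = contradiction eq (fresh c≢a (moved ∘ trans eq))
      helper (no c≢a)   (no d≢a)  = mate-uniq m
        (trans (sym (mate′-other x c≢a)) (trans eq (mate′-other x d≢a)))
        (moved ∘ trans (mate′-other x c≢a))

    coloured : Partial
    coloured = record { mate = mate′ ; mate-inv = inv ; mate-~ = λ {c} → adj {c} ; mate-uniq = uniq }

    extends : ∀ {x y} → x ~ y → Covers m x y → Covers coloured x y
    extends {x} {y} x~y (c , eq) with view c x
    ... | other x c≢a  = c , trans (mate′-other x c≢a) eq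
    ... | at-u         = contradiction x~y (~-irrefl (trans (sym freeᵤ) eq))
    ... | at-v         = contradiction x~y (~-irrefl (trans (sym freeᵥ) eq))
    ... | else x≢u x≢v = a , trans (mate′-else x≢u x≢v) eq

    reflects : ∀ {x y} → Covers coloured x y →
      Covers m x y ⊎ (x ≡ u × y ≡ v) ⊎ (x ≡ v × y ≡ u)
    reflects {x} {y} (c , eq) with view c x
    ... | other x c≢a  = inj₁ (c , trans (sym (mate′-other x c≢a)) eq)
    ... | at-u         = inj₂ (inj₁ (refl , trans (sym eq) mate′-u))
    ... | at-v         = inj₂ (inj₂ (refl , trans (sym eq) mate′-v))
    ... | else x≢u x≢v = inj₁ (a , trans (sym (mate′-else x≢u x≢v)) eq)

    covered : Covers coloured u v
    covered = a , mate′-u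

  module Uncolour (m : Partial) (a : Fin k) (v : Vertex) where

    w : Vertex
    w = mate m a v

    mate′ : Fin k → Vertex → Vertex
    mate′ c x with c ≟ a
    ... | no _  = mate m c x
    ... | yes _ with x ≟ v | x ≟ w
    ...   | yes _ | _     = x
    ...   | no _  | yes _ = x
    ...   | no _  | no _  = mate m a x

    data View : Fin k → Vertex → Set where
      same  : ∀ {c x} → (c ≡ a → x ≢ v × x ≢ w) → mate′ c x ≡ mate m c x → View c x
      freed : ∀ {x} → x ≡ v ⊎ x ≡ w → mate′ a x ≡ x → View a x

    view : ∀ c x → View c x
    view c x with c ≟ a in eqᶜ
    ... | no c≢a = same (λ c≡a → contradiction c≡a c≢a) (unfold eqᶜ)
      where
      unfold : (c ≟ a) ≡ no c≢a → mate′ c x ≡ mate m c x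
      unfold eq rewrite eq = refl
    ... | yes refl with x ≟ v in eqᵛ | x ≟ w in eqʷ
    ...   | yes p | _     = freed (inj₁ p) unfold
      where
      unfold : mate′ a x ≡ x
      unfold rewrite eqᶜ | eqᵛ = refl
    ...   | no _ | yes p = freed (inj₂ p) unfold
      where
      unfold : mate′ a x ≡ x
      unfold rewrite eqᶜ | eqᵛ | eqʷ = refl
    ...   | no x≢v | no x≢w = same (λ _ → x≢v , x≢w) unfold
      where
      unfold : mate′ a x ≡ mate m a x
      unfold rewrite eqᶜ | eqᵛ | eqʷ = refl

    freed-v : mate′ a v ≡ v
    freed-v with view a v
    ... | same keep _ = contradiction refl (proj₁ (keep refl))
    ... | freed _ eq  = eq

    mate′-keep : ∀ {c x} → Free m x c → mate′ c x ≡ x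
    mate′-keep {c} {x} free with view c x
    ... | same _ eq  = trans eq free
    ... | freed _ eq = eq

    mate′-sub : ∀ {c x} → mate′ c x ≢ x → mate′ c x ≡ mate m c x
    mate′-sub {c} {x} moved with view c x
    ... | same _ eq  = eq
    ... | freed _ eq = contradiction eq moved

    inv : ∀ c x → mate′ c (mate′ c x) ≡ x
    inv c x with view c x
    ... | freed _ eq   = trans (cong (mate′ a) eq) eq
    ... | same keep eq with view c (mate m c x)
    ...   | same _ eq′  = trans (cong (mate′ c) eq) (trans eq′ (mate-inv m c x))
    ...   | freed (inj₁ mx≡v) _ = contradiction (sym (mate-sym m mx≡v)) (proj₂ (keep refl))
    ...   | freed (inj₂ mx≡w) _ = contradiction (mate-injective m mx≡w) (proj₁ (keep refl))

    uncoloured : Partial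
    uncoloured = record
      { mate      = mate′
      ; mate-inv  = inv
      ; mate-~    = λ {c} {x} moved → subst (x ~_) (sym (mate′-sub {c} moved))
                      (mate-~ m (moved ∘ trans (mate′-sub {c} moved)))
      ; mate-uniq = λ {c} {d} eq moved → mate-uniq m
          (trans (sym (mate′-sub {c} moved)) (trans eq (mate′-sub {d} (moved ∘ trans eq))))
          (moved ∘ trans (mate′-sub {c} moved))
      }

    shrinks : ∀ {x y} → x ~ y → Covers uncoloured x y → Covers m x y
    shrinks x~y (c , refl) = c , sym (mate′-sub (λ fixed → ~-irrefl (sym fixed) x~y))

    uncovered : v ~ w → ¬ Covers uncoloured v w
    uncovered v~w (c , eq) with c≡a
      where
      moved : mate′ c v ≢ v
      moved fixed = ~-irrefl (trans (sym fixed) eq) v~w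
      c≡a : c ≡ a
      c≡a = mate-uniq m (trans (sym (mate′-sub moved)) eq) (moved ∘ trans (mate′-sub moved))
    ... | refl = ~-irrefl (trans (sym freed-v) eq) v~w

    still-covered : ∀ {x y} → Covers m x y →
      Covers uncoloured x y ⊎ (x ≡ v × y ≡ w) ⊎ (x ≡ w × y ≡ v)
    still-covered {x} (c , refl) with view c x
    ... | same _ eq         = inj₁ (c , eq)
    ... | freed (inj₁ refl) _ = inj₂ (inj₁ (refl , refl))
    ... | freed (inj₂ refl) _ = inj₂ (inj₂ (refl , mate-inv m a v))

  module Swap (m : Partial) (a b : Fin k) {S : Vertex → Set} (S? : Decidable S)
    (Sᵃ : ∀ {x} → S x → S (mate m a x)) (Sᵇ : ∀ {x} → S x → S (mate m b x)) where

    π : Vertex → Fin k → Fin k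
    π x c with S? x
    ... | yes _ = transpose a b c
    ... | no  _ = c

    π-∈ : ∀ {x} c → S x → π x c ≡ transpose a b c
    π-∈ {x} c s with S? x
    ... | yes _ = refl
    ... | no ¬s = contradiction s ¬s

    π-∉ : ∀ {x} c → ¬ S x → π x c ≡ c
    π-∉ {x} c ¬s with S? x
    ... | yes s = contradiction s ¬s
    ... | no _  = refl

    π-inv : ∀ x c → π x (π x c) ≡ c
    π-inv x c with S? x
    ... | yes _ = transpose-involutive a b c
    ... | no  _ = refl

    Sᵃ⁻ : ∀ {x} → S (mate m a x) → S x
    Sᵃ⁻ s = subst S (mate-inv m a _) (Sᵃ s)

    Sᵇ⁻ : ∀ {x} → S (mate m b x) → S x
    Sᵇ⁻ s = subst S (mate-inv m b _) (Sᵇ s)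

    transpose-∈ : ∀ c {x} → S x → S (mate m (transpose a b c) x) ⊎ transpose a b c ≡ c
    transpose-∈ c {x} s = by-cases (c ≟ a) (c ≟ b)
      where
      by-cases : Dec (c ≡ a) → Dec (c ≡ b) → S (mate m (transpose a b c) x) ⊎ transpose a b c ≡ c
      by-cases (yes refl) _          = inj₁ (subst (λ d → S (mate m d x)) (sym (transposeˡ a b)) (Sᵇ s))
      by-cases (no _)     (yes refl) = inj₁ (subst (λ d → S (mate m d x)) (sym (transposeʳ a b)) (Sᵃ s))
      by-cases (no c≢a)   (no c≢b)   = inj₂ (transpose-other c≢a c≢b)

    π-fixed : ∀ {c} → transpose a b c ≡ c → ∀ x → π x c ≡ c
    π-fixed fixed x with S? x
    ... | yes _ = fixed
    ... | no _  = refl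

    -- Both ends of an edge must agree on its new colour. An edge coloured `a` or `b` has both ends
    -- in `S` or neither, by closure and involutivity; any other colour is fixed by the
    -- transposition.
    π-mate : ∀ c x → π (mate m (π x c) x) c ≡ π x c
    π-mate c x with S? x
    ... | yes s = [ π-∈ c , (λ fixed → trans (π-fixed fixed _) (sym fixed)) ]′ (transpose-∈ c s)
    ... | no ¬s = by-cases (c ≟ a) (c ≟ b)
      where
      by-cases : Dec (c ≡ a) → Dec (c ≡ b) → π (mate m c x) c ≡ c
      by-cases (yes refl) _          = π-∉ a (¬s ∘ Sᵃ⁻)
      by-cases (no _)     (yes refl) = π-∉ b (¬s ∘ Sᵇ⁻)
      by-cases (no c≢a)   (no c≢b)   = π-fixed (transpose-other c≢a c≢b) _

    mate′ : Fin k → Vertex → Vertex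
    mate′ c x = mate m (π x c) x

    swapped : Partial
    swapped = record
      { mate      = mate′
      ; mate-inv  = λ c x → trans (cong (λ d → mate m d (mate m (π x c) x)) (π-mate c x)) (mate-inv m _ x)
      ; mate-~    = mate-~ m
      ; mate-uniq = λ {c} {d} {x} eq moved →
          trans (sym (π-inv x c)) (trans (cong (π x) (mate-uniq m eq moved)) (π-inv x d))
      }

    preserves : ∀ {x y} → Covers m x y → Covers swapped x y
    preserves {x} (c , eq) = π x c , trans (cong (λ d → mate m d x) (π-inv x c)) eq

    reflects : ∀ {x y} → Covers swapped x y → Covers m x y
    reflects {x} (c , eq) = π x c , eq

  infix 4 _⊑_
  -- Coloured edges may change colour but are never lost. Adjacency is required because a colour
  -- free at `x` makes `Covers x x` true, which colouring an edge at `x` may destroy.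
  _⊑_ : Partial → Partial → Set
  m ⊑ m′ = ∀ {x y} → x ~ y → Covers m x y → Covers m′ x y

  Extension : Partial → Vertex → Vertex → Set
  Extension m u v = ∃[ m′ ] (m ⊑ m′ × Covers m′ u v)

  colour-edge : ∀ m a {u v} → u ~ v → Free m u a → Free m v a → ¬ Covers m u v → Extension m u v
  colour-edge m a u~v freeᵤ freeᵥ ¬uv = coloured , extends , covered
    where open Colour m a u~v freeᵤ freeᵥ ¬uv

  -- A Vizing fan with two edges at `v`: the edge from `v` to `mate m a v` passes from `a` to `c`,
  -- which is free at both its ends, and `a` becomes available for the edge from `u` to `v`.
  rotate : ∀ m a c {u v} → u ~ v → ¬ Covers m u v → Free m u a → ¬ Free m v a →
    Free m v c → Free m (mate m a v) c → Extension m u v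
  rotate m a c {u} {v} u~v ¬uv freeᵤ ¬freeᵥ freeᵛᶜ freeʷᶜ =
    A.coloured , larger , A.covered
    where
    module U = Uncolour m a v
    open U using (w)
    v~w : v ~ w
    v~w = mate-~ m ¬freeᵥ
    a≢c : a ≢ c
    a≢c refl = ¬freeᵥ freeᵛᶜ
    u≢w : u ≢ w
    u≢w u≡w = ¬uv (a , mate-sym m (sym u≡w))
    module C = Colour U.uncoloured c v~w (U.mate′-keep freeᵛᶜ) (U.mate′-keep freeʷᶜ) (U.uncovered v~w)
    ¬uv′ : ¬ Covers C.coloured u v
    ¬uv′ uv with C.reflects uv
    ... | inj₁ uv′              = ¬uv (U.shrinks u~v uv′)
    ... | inj₂ (inj₁ (u≡v , _)) = ~-irrefl u≡v u~v
    ... | inj₂ (inj₂ (u≡w , _)) = u≢w u≡w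
    module A = Colour C.coloured a u~v
      (trans (C.mate′-other u a≢c) (U.mate′-keep freeᵤ))
      (trans (C.mate′-other v a≢c) U.freed-v) ¬uv′
    larger : m ⊑ A.coloured
    larger x~y xy with U.still-covered xy
    ... | inj₁ kept                  = A.extends x~y (C.extends x~y kept)
    ... | inj₂ (inj₁ (refl , refl)) = A.extends x~y C.covered
    ... | inj₂ (inj₂ (refl , refl)) = A.extends x~y (covers-sym C.coloured C.covered)

  -- The colours c and b are free at u and v.  If the chain of u misses v, then
  -- swapping frees b at both; otherwise it misses w, and swapping frees c at v,
  -- so that the edge from v to w can give up its colour a, which is free at u.
  extend : ∀ m {u v} → u ~ v → ¬ Covers m u v → Extension m u v
  extend m {u} {v} u~v ¬uv with commonFree? m u v | free-colour m u | free-colour m v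
  ... | yes (a , freeᵤ , freeᵥ) | _ | _ = colour-edge m a u~v freeᵤ freeᵥ ¬uv
  ... | no none | a , freeᵃ | b , freeᵇ with common-free m u v (mate m a v)
  ...   | inj₁ common                       = contradiction common none
  ...   | inj₂ (inj₂ (c , freeᵛᶜ , freeʷᶜ)) =
    rotate m a c u~v ¬uv freeᵃ (λ free → none (a , freeᵃ , free)) freeᵛᶜ freeʷᶜ
  ...   | inj₂ (inj₁ (c , freeᵘᶜ , freeʷᶜ)) with chain? v
    where open Alternating (mate m c) (mate m b) (mate-inv m c) (mate-inv m b) u freeᵘᶜ
  ...     | no v∉chain = m″ , (λ x~y xy → ⊑″ x~y (preserves xy)) , uv
    where
    open Alternating (mate m c) (mate m b) (mate-inv m c) (mate-inv m b) u freeᵘᶜ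
    open Swap m c b chain? p-chain q-chain
    extension : Extension swapped u v
    extension = colour-edge swapped b u~v
      (trans (cong (λ d → mate m d u) (trans (π-∈ b chain-start) (transposeʳ c b))) freeᵘᶜ)
      (trans (cong (λ d → mate m d v) (π-∉ b v∉chain)) freeᵇ)
      (¬uv ∘ reflects)
    m″ = proj₁ extension
    ⊑″ = proj₁ (proj₂ extension)
    uv = proj₂ (proj₂ extension)
  ...     | yes v∈chain = m″ , (λ x~y xy → ⊑″ x~y (preserves xy)) , uv
    where
    open Alternating (mate m c) (mate m b) (mate-inv m c) (mate-inv m b) u freeᵘᶜ
    open Swap m c b chain? p-chain q-chain
    w = mate m a v
    ¬freeᵥ : ¬ Free m v a
    ¬freeᵥ free = none (a , freeᵃ , free)
    -- Both `v`, lacking `b`, and `w`, lacking `c`, would be ends of the chain other than `u`. There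
    -- is only one such end, so `v` would equal `w` and `a` would be free at `v`.
    w∉chain : ¬ Chain w
    w∉chain w∈chain = ¬freeᵥ (trans
      (chain-end w∈chain (λ w≡u → ¬uv (a , mate-sym m w≡u)) (inj₁ freeʷᶜ))
      (sym (chain-end v∈chain (λ v≡u → ~-irrefl (sym v≡u) u~v) (inj₂ freeᵇ))))
    -- The colour `a` differs from both swapped colours, so the edge from `v` to `w` still carries
    -- it when `rotate` is applied.
    a≢c : a ≢ c
    a≢c refl = ¬freeᵥ (mate-injective m freeʷᶜ)
    a≢b : a ≢ b
    a≢b refl = ¬freeᵥ freeᵇ
    mate-a : ∀ x → mate swapped a x ≡ mate m a x
    mate-a x = cong (λ d → mate m d x) (π-fixed (transpose-other a≢c a≢b) x)
    extension : Extension swapped u v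
    extension = rotate swapped a c u~v (¬uv ∘ reflects)
      (trans (mate-a u) freeᵃ) (¬freeᵥ ∘ trans (sym (mate-a v)))
      (trans (cong (λ d → mate m d v) (trans (π-∈ c v∈chain) (transposeˡ c b))) freeᵇ)
      (subst (λ x → Free swapped x c) (sym (mate-a v))
        (trans (cong (λ d → mate m d w) (π-∉ c w∉chain)) freeʷᶜ))
    m″ = proj₁ extension
    ⊑″ = proj₁ (proj₂ extension)
    uv = proj₂ (proj₂ extension)

  cover-all : (es : List (Vertex × Vertex)) →
    ∃[ m ] (∀ {x y} → (x , y) List.∈ es → x ~ y → Covers m x y)
  cover-all []             = empty , λ ()
  cover-all ((u , v) ∷ es) with cover-all es
  ... | m , covers with u ~? v | covers? m u v
  ...   | no u≁v  | _      = m , λ where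
    (here refl) u~v → contradiction u~v u≁v
    (there e∈)  x~y → covers e∈ x~y
  ...   | yes _   | yes uv = m , λ where
    (here refl) _   → uv
    (there e∈)  x~y → covers e∈ x~y
  ...   | yes u~v | no ¬uv with extend m u~v ¬uv
  ...     | m′ , m⊑m′ , uv = m′ , λ where
    (here refl) _   → uv
    (there e∈)  x~y → m⊑m′ x~y (covers e∈ x~y)

  complete : ∃[ m ] (∀ {x y} → x ~ y → Covers m x y)
  complete with cover-all (cartesianProduct (allFin order) (allFin order))
  ... | m , covers = m , covers (∈-cartesianProduct⁺ (∈-allFin _) (∈-allFin _))

-- Depth-first spanning forests

module Traversals (G : Graph) where
  open Graph G

  -- A spanning forest grown one vertex at a time in t steps.  A visited vertex
  -- has rank < t, its time of visit; the unvisited ones all have rank t.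
  record Traversal (t : ℕ) : Set where
    field
      rank        : Vertex → ℕ
      parent      : Vertex → Maybe Vertex
      rank≤       : ∀ v → rank v ℕ.≤ t
      rank-inj    : ∀ {v w} → rank v ℕ.< t → rank v ≡ rank w → v ≡ w
      rank-onto   : ∀ {i} → i ℕ.< t → ∃[ v ] rank v ≡ i
      parent-~    : ∀ {v p} → parent v ≡ just p → p ~ v
      parent<     : ∀ {v p} → parent v ≡ just p → rank p ℕ.< rank v
      visited     : ∀ {v p} → parent v ≡ just p → rank v ℕ.< t
      root-new    : ∀ {r x y} → parent r ≡ nothing → rank r ℕ.< t →
                    rank x ℕ.< rank r → rank r ℕ.≤ rank y → ¬ x ~ y
      has-child   : ∀ {v y} → suc (rank v) ℕ.< t → v ~ y → rank v ℕ.< rank y →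
                    ∃[ w ] parent w ≡ just v

  start : Traversal 0
  start = record
    { rank      = λ _ → 0
    ; parent    = λ _ → nothing
    ; rank≤     = λ _ → z≤n
    ; rank-inj  = λ ()
    ; rank-onto = λ ()
    ; parent-~  = λ ()
    ; parent<   = λ ()
    ; visited   = λ ()
    ; root-new  = λ _ ()
    ; has-child = λ ()
    }

  module Visit {t} (T : Traversal t) {w : Vertex} (q : Maybe Vertex)
    (unvisited : Traversal.rank T w ≡ t)
    (q-visited : ∀ {p} → q ≡ just p → Traversal.rank T p ℕ.< t × p ~ w)
    (q-root : q ≡ nothing → ∀ {x y} → Traversal.rank T x ℕ.< t → Traversal.rank T y ≡ t → ¬ x ~ y)
    (q-last : ∀ {v y} → suc (Traversal.rank T v) ≡ t → v ~ y → Traversal.rank T y ≡ t → q ≡ just v)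
    where
    open Traversal T

    rank′ : Vertex → ℕ
    rank′ x with rank x ℕ.<? t | x ≟ w
    ... | yes _ | _     = rank x
    ... | no _  | yes _ = t
    ... | no _  | no _  = suc t

    parent′ : Vertex → Maybe Vertex
    parent′ x with x ≟ w
    ... | yes _ = q
    ... | no _  = parent x

    data View (x : Vertex) : Set where
      old  : rank x ℕ.< t → rank′ x ≡ rank x → parent′ x ≡ parent x → View x
      new  : x ≡ w → rank x ≡ t → rank′ x ≡ t → parent′ x ≡ q → View x
      rest : x ≢ w → rank x ≡ t → rank′ x ≡ suc t → parent′ x ≡ parent x → View x

    view : ∀ x → View x
    view x with rank x ℕ.<? t in eq | x ≟ w in eqʷ
    ... | yes x<t | yes refl = contradiction unvisited (<⇒≢ x<t)
    ... | yes x<t | no _     = old x<t unfold unfold′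
      where
      unfold : rank′ x ≡ rank x
      unfold rewrite eq = refl
      unfold′ : parent′ x ≡ parent x
      unfold′ rewrite eqʷ = refl
    ... | no x≮t  | yes x≡w  = new x≡w (≤-antisym (rank≤ x) (≮⇒≥ x≮t)) unfold unfold′
      where
      unfold : rank′ x ≡ t
      unfold rewrite eq | eqʷ = refl
      unfold′ : parent′ x ≡ q
      unfold′ rewrite eqʷ = refl
    ... | no x≮t  | no x≢w   = rest x≢w (≤-antisym (rank≤ x) (≮⇒≥ x≮t)) unfold unfold′
      where
      unfold : rank′ x ≡ suc t
      unfold rewrite eq | eqʷ = refl
      unfold′ : parent′ x ≡ parent x
      unfold′ rewrite eqʷ = refl

    rank≤rank′ : ∀ x → rank x ℕ.≤ rank′ x
    rank≤rank′ x with view x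
    ... | old _ eq _     = ≤-reflexive (sym eq)
    ... | new _ a b _    = ≤-reflexive (trans a (sym b))
    ... | rest _ a b _     = ≤-trans (≤-reflexive a) (≤-trans (n≤1+n t) (≤-reflexive (sym b)))

    rank′-old : ∀ {x} → rank x ℕ.< t → rank′ x ≡ rank x
    rank′-old {x} x<t with view x
    ... | old _ eq _  = eq
    ... | new _ a _ _ = contradiction a (<⇒≢ x<t)
    ... | rest _ a _ _  = contradiction a (<⇒≢ x<t)

    rank′-w : rank′ w ≡ t
    rank′-w with view w
    ... | old w<t _ _   = contradiction unvisited (<⇒≢ w<t)
    ... | new _ _ eq _  = eq
    ... | rest w≢w _ _ _ = contradiction refl w≢w

    old-if : ∀ {x} → rank′ x ℕ.< t → rank x ℕ.< t
    old-if {x} x<t = ≤-<-trans (rank≤rank′ x) x<t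

    reaches : ∀ {x y} → rank x ℕ.< t → rank x ℕ.< rank′ y → rank x ℕ.< rank y
    reaches {x} {y} x<t x<y with view y
    ... | old _ eq _  = subst (rank x ℕ.<_) eq x<y
    ... | new _ a _ _ = subst (rank x ℕ.<_) (sym a) x<t
    ... | rest _ a _ _  = subst (rank x ℕ.<_) (sym a) x<t

    visit : Traversal (suc t)
    visit = record
      { rank      = rank′
      ; parent    = parent′
      ; rank≤     = rank′≤
      ; rank-inj  = inj
      ; rank-onto = onto
      ; parent-~  = par~
      ; parent<   = par<
      ; visited   = vis
      ; root-new  = root
      ; has-child = child
      }
      where
      rank′≤ : ∀ v → rank′ v ℕ.≤ suc t
      rank′≤ v with view v
      ... | old v<t eq _  = ≤-trans (≤-reflexive eq) (<⇒≤ (m<n⇒m<1+n v<t))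
      ... | new _ _ eq _  = ≤-trans (≤-reflexive eq) (n≤1+n t)
      ... | rest _ _ eq _   = ≤-reflexive eq
      inj : ∀ {v w} → rank′ v ℕ.< suc t → rank′ v ≡ rank′ w → v ≡ w
      inj {v} {x} v<t eq with view v | view x
      ... | old a b _   | old a′ b′ _     = rank-inj a (trans (sym b) (trans eq b′))
      ... | old a b _   | new _ _ b′ _    = contradiction (trans (sym b) (trans eq b′)) (<⇒≢ a)
      ... | old a b _   | rest _ _ b′ _     = contradiction (trans (sym b) (trans eq b′)) (<⇒≢ (m<n⇒m<1+n a))
      ... | new _ _ b _ | old a′ b′ _     = contradiction (trans (sym b′) (trans (sym eq) b)) (<⇒≢ a′)
      ... | new a _ _ _ | new a′ _ _ _    = trans a (sym a′)
      ... | new _ _ b _ | rest _ _ b′ _     = contradiction (trans (sym b) (trans eq b′)) (<⇒≢ (n<1+n t))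
      ... | rest _ _ b _  | _               = contradiction b (<⇒≢ v<t)
      onto : ∀ {i} → i ℕ.< suc t → ∃[ v ] rank′ v ≡ i
      onto {i} i≤t with i ℕ.≟ t
      ... | yes refl = w , rank′-w
      ... | no i≢t with rank-onto (≤∧≢⇒< (≤-pred i≤t) i≢t)
      ...   | v , refl = v , rank′-old (≤∧≢⇒< (≤-pred i≤t) i≢t)
      par~ : ∀ {v p} → parent′ v ≡ just p → p ~ v
      par~ {v} eq with view v
      ... | old _ _ same      = parent-~ (trans (sym same) eq)
      ... | new refl _ _ same = proj₂ (q-visited (trans (sym same) eq))
      ... | rest _ _ _ same     = parent-~ (trans (sym same) eq)
      par< : ∀ {v p} → parent′ v ≡ just p → rank′ p ℕ.< rank′ v
      par< {v} {p} eq with view v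
      ... | old v<t b same = subst₂ ℕ._<_ (sym (rank′-old (<-trans p<v v<t))) (sym b) p<v
        where
        p<v : rank p ℕ.< rank v
        p<v = parent< (trans (sym same) eq)
      ... | new _ _ b same = subst₂ ℕ._<_ (sym (rank′-old p<t)) (sym b) p<t
        where
        p<t : rank p ℕ.< t
        p<t = proj₁ (q-visited (trans (sym same) eq))
      ... | rest _ a _ same = contradiction a (<⇒≢ (visited (trans (sym same) eq)))
      vis : ∀ {v p} → parent′ v ≡ just p → rank′ v ℕ.< suc t
      vis {v} eq with view v
      ... | old v<t b _   = subst (ℕ._< suc t) (sym b) (m<n⇒m<1+n v<t)
      ... | new _ _ b _   = subst (ℕ._< suc t) (sym b) (n<1+n t)
      ... | rest _ a _ same = contradiction a (<⇒≢ (visited (trans (sym same) eq)))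
      root : ∀ {r x y} → parent′ r ≡ nothing → rank′ r ℕ.< suc t →
             rank′ x ℕ.< rank′ r → rank′ r ℕ.≤ rank′ y → ¬ x ~ y
      root {r} {x} {y} eq r<t x<r r≤y with view r
      ... | old v<t b same = root-new (trans (sym same) eq) v<t x<r₀ r≤y₀
        where
        x<r₀ : rank x ℕ.< rank r
        x<r₀ = ≤-<-trans (rank≤rank′ x) (subst (rank′ x ℕ.<_) b x<r)
        r≤y₀ : rank r ℕ.≤ rank y
        r≤y₀ with view y
        ... | old _ b′ _  = subst₂ ℕ._≤_ b b′ r≤y
        ... | new _ a _ _ = subst (rank r ℕ.≤_) (sym a) (rank≤ r)
        ... | rest _ a _ _  = subst (rank r ℕ.≤_) (sym a) (rank≤ r)
      ... | new _ _ b same = q-root (trans (sym same) eq)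
        (≤-<-trans (rank≤rank′ x) (subst (rank′ x ℕ.<_) b x<r)) y-unvisited
        where
        y-unvisited : rank y ≡ t
        y-unvisited with view y
        ... | old y<t b′ _ = contradiction (≤-trans (≤-reflexive (sym b)) (≤-trans r≤y (≤-reflexive b′))) (<⇒≱ y<t)
        ... | new _ a _ _  = a
        ... | rest _ a _ _   = a
      ... | rest _ _ b _ = contradiction b (<⇒≢ r<t)
      child : ∀ {v y} → suc (rank′ v) ℕ.< suc t → v ~ y → rank′ v ℕ.< rank′ y →
              ∃[ x ] parent′ x ≡ just v
      child {v} {y} (s≤s v<t′) v~y v<y′ with old-if v<t′
      ... | v<t with reaches {v} {y} v<t (subst (ℕ._< rank′ y) (rank′-old v<t) v<y′) | suc (rank v) ℕ.≟ t
      -- Until now `v` was the vertex visited last and `y` is unvisited, so by `q-last` the vertex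
      -- `w` is attached to `v`.
      ...   | v<y | yes last = w , trans parent′-w (q-last last v~y
        (≤-antisym (rank≤ y) (subst (ℕ._≤ rank y) last v<y)))
        where
        parent′-w : parent′ w ≡ q
        parent′-w with w ≟ w
        ... | yes _  = refl
        ... | no w≢w = contradiction refl w≢w
      ...   | v<y | no ¬last with has-child (≤∧≢⇒< v<t ¬last) v~y v<y
      ...     | x , eq with view x
      ...       | old _ _ same  = x , trans same eq
      ...       | new _ a _ _   = contradiction a (<⇒≢ (visited eq))
      ...       | rest _ a _ _    = contradiction a (<⇒≢ (visited eq))

  -- The order of preference matters. Continuing from the vertex visited last gives `has-child`: a
  -- vertex with an unvisited neighbour gets a child right after its own visit. Trying all visited
  -- vertices before opening a new tree gives `root-new`.
  step : ∀ {t} (T : Traversal t) →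
    (∀ v → Traversal.rank T v ℕ.< t) ⊎ Traversal (suc t)
  step {t} T
    with any? (λ v → any? (λ w → (suc (rank v) ℕ.≟ t) ×-dec (v ~? w) ×-dec (rank w ℕ.≟ t)))
       | any? (λ p → any? (λ w → (rank p ℕ.<? t) ×-dec (p ~? w) ×-dec (rank w ℕ.≟ t)))
       | any? (λ w → rank w ℕ.≟ t)
    where open Traversal T
  ... | yes (v , w , last , v~w , w≡t) | _ | _ = inj₂ (Visit.visit T (just v) w≡t
    (λ where refl → ≤-reflexive last , v~w) (λ ())
    (λ last′ _ _ → cong just (Traversal.rank-inj T (≤-reflexive last) (suc-injective (trans last (sym last′))))))
  ... | no ¬last | yes (p , w , p<t , p~w , w≡t) | _ = inj₂ (Visit.visit T (just p) w≡t
    (λ where refl → p<t , p~w) (λ ())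
    (λ last v~y y≡t → contradiction (_ , _ , last , v~y , y≡t) ¬last))
  ... | no ¬last | no ¬p | yes (w , w≡t) = inj₂ (Visit.visit T nothing w≡t
    (λ ()) (λ _ x<t y≡t x~y → ¬p (_ , _ , x<t , x~y , y≡t))
    (λ last v~y y≡t → contradiction (_ , _ , last , v~y , y≡t) ¬last))
  ... | no _ | no _ | no none = inj₁ (λ v → ≤∧≢⇒< (Traversal.rank≤ T v) (λ v≡t → none (v , v≡t)))

  grow : ∀ fuel {t} → Traversal t → fuel + t ≡ suc order →
    ∃[ s ] Σ (Traversal s) (λ T → ∀ v → Traversal.rank T v ℕ.< s)
  -- By now `suc order` different ranks would be attained by only `order` vertices.
  grow zero {t} T refl with Fin.pigeonhole (n<1+n order) (λ i → proj₁ (Traversal.rank-onto T (Fin.toℕ<n i)))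
  ... | i , j , i<j , eq = contradiction
    (trans (sym (proj₂ (rank-onto (Fin.toℕ<n i)))) (trans (cong rank eq) (proj₂ (rank-onto (Fin.toℕ<n j)))))
    (<⇒≢ i<j)
    where open Traversal T
  grow (suc fuel) {t} T eq with step T
  ... | inj₁ done = t , T , done
  ... | inj₂ T′   = grow fuel T′ (trans (+-suc fuel t) eq)

  -- A spanning forest in which every edge from a childless vertex goes to an
  -- earlier vertex, and a new tree is begun only when the vertices visited so
  -- far form a union of components.
  record Forest : Set where
    field
      rank        : Vertex → ℕ
      parent      : Vertex → Maybe Vertex
      rank-inj    : ∀ {v w} → rank v ≡ rank w → v ≡ w
      parent-~    : ∀ {v p} → parent v ≡ just p → p ~ v
      parent<     : ∀ {v p} → parent v ≡ just p → rank p ℕ.< rank v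
      root-new    : ∀ {r x y} → parent r ≡ nothing →
                    rank x ℕ.< rank r → rank r ℕ.≤ rank y → ¬ x ~ y
      has-child   : ∀ {v y} → v ~ y → rank v ℕ.< rank y → ∃[ w ] parent w ≡ just v

  forest : Forest
  forest with grow (suc order) start (+-identityʳ (suc order))
  ... | s , T , done = record
    { rank      = rank
    ; parent    = parent
    ; rank-inj  = rank-inj (done _)
    ; parent-~  = parent-~
    ; parent<   = parent<
    ; root-new  = λ eq → root-new eq (done _)
    ; has-child = λ v~y v<y → has-child (≤-<-trans v<y (done _)) v~y v<y
    }
    where open Traversal T

-- Greedy colouring of the forest edges

module TreeColouring (G : Graph) (F : Traversals.Forest G) where
  open Graph G
  open GraphProperties G
  open Traversals.Forest F

  parent? : ∀ w p → Dec (parent w ≡ just p)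
  parent? w p = Maybe.≡-dec _≟_ (parent w) (just p)

  HasParent : Vertex → Set
  HasParent v = ∃[ p ] parent v ≡ just p

  Colour : Set
  Colour = Fin (2 + Δ)

  -- The forest colours at `v`. At a root `ψ v` belongs to no edge, hence the guard `HasParent v`.
  Palette : (Vertex → Colour) → Vertex → Colour → Set
  Palette ψ v β = (HasParent v × ψ v ≡ β) ⊎ ∃[ w ] (parent w ≡ just v × ψ w ≡ β)

  palette-cong : ∀ {ψ ψ′ v} → (HasParent v → ψ v ≡ ψ′ v) →
    (∀ w → parent w ≡ just v → ψ w ≡ ψ′ w) → Palette ψ v ⊆ Palette ψ′ v
  palette-cong up down (inj₁ (hp , eq))     = inj₁ (hp , trans (sym (up hp)) eq)
  palette-cong up down (inj₂ (w , pw , eq)) = inj₂ (w , pw , trans (sym (down w pw)) eq)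

  -- Children are compared by vertex index, not by time of visit, matching the order in which
  -- `priority` treats the edges below `p`.
  Last : Vertex → Vertex → Set
  Last w p = ∀ w′ → parent w′ ≡ just p → w′ Fin.≤ w

  last-child : ∀ {p} → ∃[ w ] parent w ≡ just p → ∃[ w ] (parent w ≡ just p × Last w p)
  last-child {p} = greatest (λ w → parent? w p)

  -- Zero is reserved for the edge from a root to its last child.
  Starred : Vertex → Vertex → Set
  Starred w p = Last w p × parent p ≡ nothing

  starred? : ∀ w p → Dec (Starred w p)
  starred? w p = all? (λ w′ → parent? w′ p →-dec (w′ Fin.≤? w)) ×-dec Maybe.≡-dec _≟_ (parent p) nothing

  record Plain (w p : Vertex) (ψ : Vertex → Colour) : Set where
    field
      nonzero      : ψ w ≢ zero
      ≢-parent     : HasParent p → ψ w ≢ ψ p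
      ≢-sibling    : ∀ w′ → parent w′ ≡ just p → w′ Fin.< w → ψ w ≢ ψ w′
      distinguish  : Last w p → ∀ x → x ~ p → rank x ℕ.< rank p →
                     ¬ (Palette ψ p ≐ Palette ψ x)
  open Plain

  -- ψ w is the colour of the edge from w to its parent.
  Good : Vertex → (Vertex → Colour) → Set
  Good w ψ = ∀ p → parent w ≡ just p →
    (Starred w p → ψ w ≡ zero) × (¬ Starred w p → Plain w p ψ)

  -- The edges are coloured in the order of their upper ends.
  priority : Vertex → ℕ
  priority w = toℕ w + rank (fromMaybe w (parent w)) ℕ.* order

  priority-child : ∀ {w p} → parent w ≡ just p → priority w ≡ toℕ w + rank p ℕ.* order
  priority-child eq rewrite eq = refl

  lexicographic : ∀ {v w r s} → r ℕ.< s → toℕ {order} v + r ℕ.* order ℕ.< toℕ {order} w + s ℕ.* order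
  lexicographic {v} {w} {r} {s} r<s = begin-strict
    toℕ v + r ℕ.* order <⟨ +-monoˡ-< (r ℕ.* order) (Fin.toℕ<n v) ⟩
    suc r ℕ.* order     ≤⟨ *-monoˡ-≤ order r<s ⟩
    s ℕ.* order         ≤⟨ m≤n+m (s ℕ.* order) (toℕ w) ⟩
    toℕ w + s ℕ.* order ∎
    where open ≤-Reasoning

  priority-inj : ∀ {v w} → priority v ≡ priority w → v ≡ w
  priority-inj {v} {w} eq with <-cmp (rank (fromMaybe v (parent v))) (rank (fromMaybe w (parent w)))
  ... | tri< r<s _ _ = contradiction eq (<⇒≢ (lexicographic {v} {w} r<s))
  ... | tri> _ _ s<r = contradiction (sym eq) (<⇒≢ (lexicographic {w} {v} s<r))
  ... | tri≈ _ r≡s _ = Fin.toℕ-injective (+-cancelʳ-≡ _ (toℕ v) (toℕ w)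
    (trans eq (cong (λ r → toℕ w + r ℕ.* order) (sym r≡s))))

  earlier : ∀ {v w p q} → parent v ≡ just p → parent w ≡ just q → rank p ℕ.< rank q →
    priority v ℕ.≤ priority w
  earlier {v} {w} pv pw p<q = subst₂ ℕ._≤_ (sym (priority-child pv)) (sym (priority-child pw))
    (<⇒≤ (lexicographic {v} {w} p<q))

  sibling-earlier : ∀ {v w p} → parent v ≡ just p → parent w ≡ just p → v Fin.≤ w →
    priority v ℕ.≤ priority w
  sibling-earlier {p = p} pv pw v≤w = subst₂ ℕ._≤_ (sym (priority-child pv)) (sym (priority-child pw))
    (+-monoˡ-≤ (rank p ℕ.* order) v≤w)

  -- All edges concerned have `p` or an earlier neighbour of `p` as an end, so their upper ends have
  -- rank at most that of `p`. The full palette of `p` enters only when `w` is its last child, and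
  -- then no edge below `p` comes later.
  good-local : ∀ w {ψ ψ′} → (∀ j → priority j ℕ.≤ priority w → ψ j ≡ ψ′ j) → Good w ψ → Good w ψ′
  good-local w {ψ} {ψ′} agree good p pw =
    (λ starred → trans (sym agree-w) (proj₁ (good p pw) starred)) ,
    (λ ¬starred → transfer (proj₂ (good p pw) ¬starred))
    where
    agree-w : ψ w ≡ ψ′ w
    agree-w = agree w ≤-refl
    agree-p : HasParent p → ψ p ≡ ψ′ p
    agree-p (g , pp) = agree p (earlier pp pw (parent< pp))
    agree-sibling : ∀ w′ → parent w′ ≡ just p → w′ Fin.≤ w → ψ w′ ≡ ψ′ w′
    agree-sibling w′ pw′ w′≤w = agree w′ (sibling-earlier pw′ pw w′≤w)
    transfer : Plain w p ψ → Plain w p ψ′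
    transfer plain = record
      { nonzero     = nonzero plain ∘ trans agree-w
      ; ≢-parent    = λ hp eq → ≢-parent plain hp (trans agree-w (trans eq (sym (agree-p hp))))
      ; ≢-sibling   = λ w′ pw′ w′<w eq → ≢-sibling plain w′ pw′ w′<w
          (trans agree-w (trans eq (sym (agree-sibling w′ pw′ (<⇒≤ w′<w)))))
      ; distinguish = λ last x x~p x<p (⊆ , ⊇) →
          let up : HasParent x → ψ x ≡ ψ′ x
              up = λ (_ , px) → agree x (earlier px pw (<-trans (parent< px) x<p))
              down : ∀ v → parent v ≡ just x → ψ v ≡ ψ′ v
              down = λ v pv → agree v (earlier pv pw x<p)
              siblings : ∀ v → parent v ≡ just p → ψ v ≡ ψ′ v
              siblings = λ v pv → agree-sibling v pv (last v pv)
          in distinguish plain last x x~p x<p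
            ( (λ β → palette-cong (sym ∘ up) (λ v → sym ∘ down v) (⊆ (palette-cong agree-p siblings β)))
            , (λ β → palette-cong (sym ∘ agree-p) (λ v → sym ∘ siblings v) (⊇ (palette-cong up down β))))
      }

  module Step (ψ : Vertex → Colour) {w p : Vertex} (pw : parent w ≡ just p) where

    -- The colours at `p` apart from that of the edge to `w`. Provisional values at siblings still
    -- to be coloured are included; each is charged to its own vertex.
    Base : Colour → Set
    Base β = (HasParent p × ψ p ≡ β) ⊎ ∃[ w′ ] (parent w′ ≡ just p × w′ ≢ w × ψ w′ ≡ β)

    -- Each neighbour y of p rules out at most one colour for the edge from w to
    -- p: the vertex w does so for the parent of p.
    Rules : Vertex → Fin (suc Δ) → Set
    Rules y α = p ~ y ×
      ( (y ≡ w × HasParent p × ψ p ≡ suc α)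
      ⊎ (y ≢ w × parent y ≡ just p × ψ y ≡ suc α)
      ⊎ (rank y ℕ.< rank p × ¬ Base (suc α) × Palette ψ y (suc α) ×
         (∀ β → Palette ψ y β → Base β ⊎ β ≡ suc α)))

    hasParent? : ∀ v → Dec (HasParent v)
    hasParent? v = any? (parent? v)

    base? : ∀ β → Dec (Base β)
    base? β = (hasParent? p ×-dec (ψ p ≟ β)) ⊎-dec
      any? (λ w′ → parent? w′ p ×-dec ¬? (w′ ≟ w) ×-dec (ψ w′ ≟ β))

    palette? : ∀ v β → Dec (Palette ψ v β)
    palette? v β = (hasParent? v ×-dec (ψ v ≟ β)) ⊎-dec
      any? (λ w′ → parent? w′ v ×-dec (ψ w′ ≟ β))

    rules? : ∀ y α → Dec (Rules y α)
    rules? y α = (p ~? y) ×-dec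
      (((y ≟ w) ×-dec hasParent? p ×-dec (ψ p ≟ suc α)) ⊎-dec
       (¬? (y ≟ w) ×-dec parent? y p ×-dec (ψ y ≟ suc α)) ⊎-dec
       ((rank y ℕ.<? rank p) ×-dec ¬? (base? (suc α)) ×-dec palette? y (suc α) ×-dec
        all? (λ β → palette? y β →-dec (base? β ⊎-dec (β ≟ suc α)))))

    -- The three kinds of ruling exclude one another, as children of `p` have larger rank. Within
    -- the last kind, `suc α` is in the palette of `y` but outside `Base`, where the second ruling
    -- admits only `suc β`.
    rules-one : ∀ {y α β} → Rules y α → Rules y β → α ≡ β
    rules-one (_ , inj₁ (_ , _ , a)) (_ , inj₁ (_ , _ , b)) = Fin.suc-injective (trans (sym a) b)
    rules-one (_ , inj₁ (y≡w , _)) (_ , inj₂ (inj₁ (y≢w , _))) = contradiction y≡w y≢w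
    rules-one (_ , inj₁ (refl , _)) (_ , inj₂ (inj₂ (w<p , _))) = contradiction (parent< pw) (<⇒≯ w<p)
    rules-one (_ , inj₂ (inj₁ (y≢w , _))) (_ , inj₁ (y≡w , _)) = contradiction y≡w y≢w
    rules-one (_ , inj₂ (inj₁ (_ , _ , a))) (_ , inj₂ (inj₁ (_ , _ , b))) = Fin.suc-injective (trans (sym a) b)
    rules-one (_ , inj₂ (inj₁ (_ , py , _))) (_ , inj₂ (inj₂ (y<p , _))) = contradiction (parent< py) (<⇒≯ y<p)
    rules-one (_ , inj₂ (inj₂ (w<p , _))) (_ , inj₁ (refl , _)) = contradiction (parent< pw) (<⇒≯ w<p)
    rules-one (_ , inj₂ (inj₂ (y<p , _))) (_ , inj₂ (inj₁ (_ , py , _))) = contradiction (parent< py) (<⇒≯ y<p)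
    rules-one (_ , inj₂ (inj₂ (_ , ¬b , y∋α , _))) (_ , inj₂ (inj₂ (_ , _ , _ , sub))) with sub _ y∋α
    ... | inj₁ b  = contradiction b ¬b
    ... | inj₂ eq = Fin.suc-injective eq

    -- The candidates are the Δ + 1 colours `suc α`, so `zero` stays reserved; with it they make up
    -- the Δ + 2 new colours.
    choice : ∃[ α ] (∀ y → ¬ Rules y α)
    choice = escape rules? (neighbourhood p) (λ (p~y , _) → ∈neighbourhood⁺ p~y) rules-one
      (s≤s (degree≤Δ p))

    module Extended (α : Fin (suc Δ)) (unruled : ∀ y → ¬ Rules y α) where

      ψ′ : Vertex → Colour
      ψ′ = updateAt ψ w (const (suc α))

      ψ′-w : ψ′ w ≡ suc α
      ψ′-w = updateAt-updates w ψ

      ψ′-else : ∀ {v} → v ≢ w → ψ′ v ≡ ψ v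
      ψ′-else {v} = updateAt-minimal v w ψ

      p≢w : p ≢ w
      p≢w refl = <-irrefl refl (parent< pw)

      ¬base : ¬ Base (suc α)
      ¬base (inj₁ (hp , eq))            = unruled w (parent-~ pw , inj₁ (refl , hp , eq))
      ¬base (inj₂ (v , pv , v≢w , eq)) = unruled v (parent-~ pv , inj₂ (inj₁ (v≢w , pv , eq)))

      palette′-p : ∀ {β} → Palette ψ′ p β → Base β ⊎ β ≡ suc α
      palette′-p (inj₁ (hp , eq)) = inj₁ (inj₁ (hp , trans (sym (ψ′-else p≢w)) eq))
      palette′-p (inj₂ (v , pv , eq)) with v ≟ w
      ... | yes refl = inj₂ (trans (sym eq) ψ′-w)
      ... | no v≢w   = inj₁ (inj₂ (v , pv , v≢w , trans (sym (ψ′-else v≢w)) eq))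

      plain : Plain w p ψ′
      plain = record
        { nonzero     = λ eq → contradiction (trans (sym ψ′-w) eq) λ ()
        ; ≢-parent    = λ hp eq → ¬base (inj₁ (hp ,
            trans (sym (ψ′-else p≢w)) (trans (sym eq) ψ′-w)))
        ; ≢-sibling   = λ w′ pw′ w′<w eq → ¬base (inj₂ (w′ , pw′ , Fin.<⇒≢ w′<w ,
            trans (sym (ψ′-else (Fin.<⇒≢ w′<w))) (trans (sym eq) ψ′-w)))
        -- An earlier neighbour `x` with the same palette would have ruled out `α`. The update at
        -- `w` leaves its palette alone, because `w` is neither `x` nor a child of `x`.
        ; distinguish = λ _ x x~p x<p (⊆ , ⊇) →
            let x≢w : x ≢ w
                x≢w = λ where refl → <⇒≯ x<p (parent< pw)
                child≢w : ∀ v → parent v ≡ just x → v ≢ w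
                child≢w = λ where v pv refl → <-irrefl (cong rank (just-injective (trans (sym pv) pw))) x<p
            in unruled x (~-sym x~p , inj₂ (inj₂ (x<p , ¬base
              , palette-cong (λ _ → ψ′-else x≢w) (λ v pv → ψ′-else (child≢w v pv)) (⊆ (inj₂ (w , pw , ψ′-w)))
              , λ β β∈ → palette′-p (⊇ (palette-cong (λ _ → sym (ψ′-else x≢w)) (λ v pv → sym (ψ′-else (child≢w v pv))) β∈)))))
        }

  good-step : ∀ w ψ → ∃[ a ] Good w (updateAt ψ w (const a))
  good-step w ψ with parent w in pw
  -- A root has no edge upwards, so `zero` is a mere placeholder here.
  ... | nothing = zero , λ _ ()
  ... | just p with starred? w p
  ...   | yes starred = zero , λ where
    .p refl → (λ _ → updateAt-updates w ψ) , contradiction starred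
  ...   | no ¬starred with Step.choice ψ pw
  ...     | α , unruled = suc α , λ where
    .p refl → (λ starred → contradiction starred ¬starred) , λ _ → Step.Extended.plain ψ pw α unruled

  good-colouring : ∃[ ψ ] (∀ w → Good w ψ)
  good-colouring with greedy priority priority-inj Good good-local good-step (λ _ → zero)
                        (suc (max 0 (List.map priority (allFin order))))
  ... | ψ , good = ψ , λ w →
    good w (s≤s (All.lookup (All.map⁻ (xs≤max 0 (List.map priority (allFin order)))) (∈-allFin w)))

-- Adjacent vertices have different palettes

module Normality (G : Graph) where
  open Graph G
  open GraphProperties G

  degree≡1 : ∀ {v w} → v ~ w → (∀ {y} → v ~ y → y ≡ w) → degree v ≡ 1
  degree≡1 {v} {w} v~w only = trans (cong ∣_∣ (⊆-antisym
    (λ y∈ → subst (_∈ ⁅ w ⁆) (sym (only (∈neighbourhood⁻ y∈))) (x∈⁅x⁆ w))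
    (λ y∈ → subst (_∈ neighbourhood v) (sym (x∈⁅y⁆⇒x≡y w y∈)) (∈neighbourhood⁺ v~w))))
    (∣⁅x⁆∣≡1 w)

  ¬isolated : Normal → ∀ {v w} → v ~ w → (∀ {y} → v ~ y → y ≡ w) → ¬ (∀ {y} → w ~ y → y ≡ v)
  ¬isolated normal {v} {w} v~w onlyᵥ onlyʷ with Fin.<-cmp v w
  ... | tri< v<w _ _ = normal (edge v w v<w v~w) (degree≡1 v~w onlyᵥ , degree≡1 (~-sym v~w) onlyʷ)
  ... | tri≈ _ v≡w _ = ~-irrefl v≡w v~w
  ... | tri> _ _ w<v = normal (edge w v w<v (~-sym v~w)) (degree≡1 (~-sym v~w) onlyʷ , degree≡1 v~w onlyᵥ)

module Distinguishing (G : Graph) (F : Traversals.Forest G)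
  (ψ : Graph.Vertex G → TreeColouring.Colour G F) (good : ∀ w → TreeColouring.Good G F w ψ) where
  open Graph G
  open Traversals.Forest F
  open TreeColouring G F
  open Plain
  open Normality G

  plain : ∀ {w p} → parent w ≡ just p → ¬ Starred w p → Plain w p ψ
  plain {w} {p} pw = proj₂ (good w p pw)

  ψ-parent : ∀ {w p} → parent w ≡ just p → HasParent p → ψ w ≢ ψ p
  ψ-parent pw (g , pp) = ≢-parent (plain pw ¬starred) (g , pp)
    where
    ¬starred : ¬ Starred _ _
    ¬starred (_ , root) = contradiction (trans (sym pp) root) λ ()

  -- When `w` carries the reserved colour, the difference comes from `v`: not being last, it has a
  -- nonzero colour.
  earlier-sibling : ∀ {v w p} → parent v ≡ just p → parent w ≡ just p → v Fin.< w → ψ v ≢ ψ w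
  earlier-sibling {v} {w} {p} pv pw v<w eq with starred? w p
  ... | yes starred = nonzero (plain pv (λ (last , _) → <⇒≱ v<w (last w pw)))
                        (trans eq (proj₁ (good w p pw) starred))
  ... | no ¬starred = ≢-sibling (plain pw ¬starred) v pv v<w (sym eq)

  ψ-sibling : ∀ {v w p} → parent v ≡ just p → parent w ≡ just p → ψ v ≡ ψ w → v ≡ w
  ψ-sibling {v} {w} pv pw eq with Fin.<-cmp v w
  ... | tri< v<w _ _ = contradiction eq (earlier-sibling pv pw v<w)
  ... | tri≈ _ v≡w _ = v≡w
  ... | tri> _ _ w<v = contradiction (sym eq) (earlier-sibling pw pv w<v)

  has-parent : ∀ {u v} → u ~ v → rank u ℕ.< rank v → HasParent v
  has-parent {u} {v} u~v u<v with parent v in pv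
  ... | just p  = p , refl
  ... | nothing = contradiction u~v (root-new pv u<v ≤-refl)

  module _ {r ℓ} (root : parent r ≡ nothing) (pℓ : parent ℓ ≡ just r)
    (only-child : ∀ w → parent w ≡ just r → w ≡ ℓ) (childless : ∀ w → parent w ≢ just ℓ) where

    -- Induction on the rank of `y`, bounded by `b`. With no other root up to `y`, its parent is not
    -- earlier than `r`, and if it is later than `r` it is `ℓ` by induction, which has no children;
    -- so the parent is `r`.
    tree-of-r : ∀ b y → rank y ℕ.< b → rank r ℕ.< rank y →
      (∀ z → parent z ≡ nothing → rank r ℕ.< rank z → ¬ rank z ℕ.≤ rank y) → y ≡ ℓ
    tree-of-r (suc b) y y<b r<y no-root with parent y in py
    ... | nothing = contradiction ≤-refl (no-root y py r<y)
    ... | just p with <-cmp (rank p) (rank r)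
    ...   | tri< p<r _ _ = contradiction (parent-~ py) (root-new root p<r (<⇒≤ r<y))
    ...   | tri≈ _ p≡r _ = only-child y (trans py (cong just (rank-inj p≡r)))
    ...   | tri> _ _ r<p = contradiction (trans py (cong just p≡ℓ)) (childless y)
      where
      p<y : rank p ℕ.< rank y
      p<y = parent< py
      p≡ℓ : p ≡ ℓ
      p≡ℓ = tree-of-r b p (≤-trans p<y (≤-pred y<b)) r<p
        (λ z rz r<z z≤p → no-root z rz r<z (≤-trans z≤p (<⇒≤ p<y)))

    r~ℓ : r ~ ℓ
    r~ℓ = parent-~ pℓ

    r-neighbour : ∀ {y} → r ~ y → y ≡ ℓ
    r-neighbour {y} r~y with <-cmp (rank y) (rank r)
    ... | tri< y<r _ _ = contradiction (~-sym r~y) (root-new root y<r ≤-refl)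
    ... | tri≈ _ y≡r _ = contradiction r~y (~-irrefl (sym (rank-inj y≡r)))
    ... | tri> _ _ r<y = tree-of-r _ y ≤-refl r<y
      (λ z rz r<z z≤y → root-new rz r<z z≤y r~y)

    ℓ-neighbour : ∀ {y} → ℓ ~ y → y ≡ r
    ℓ-neighbour {y} ℓ~y with <-cmp (rank y) (rank r)
    ... | tri< y<r _ _ = contradiction (~-sym ℓ~y) (root-new root y<r (<⇒≤ (parent< pℓ)))
    ... | tri≈ _ y≡r _ = rank-inj y≡r
    ... | tri> _ _ r<y = contradiction ℓ~y (~-irrefl (sym (tree-of-r _ y ≤-refl r<y no-root)))
      where
      -- A root cuts all earlier vertices off from itself and everything later. One up to `ℓ` would
      -- cut the edge from `r` to `ℓ`, one beyond `ℓ` the edge from `ℓ` to `y`.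
      no-root : ∀ z → parent z ≡ nothing → rank r ℕ.< rank z → ¬ rank z ℕ.≤ rank y
      no-root z rz r<z z≤y with rank z ℕ.≤? rank ℓ
      ... | yes z≤ℓ = root-new rz r<z z≤ℓ r~ℓ
      ... | no z≰ℓ  = root-new rz (≰⇒> z≰ℓ) z≤y ℓ~y

  distinct-earlier : Normal → ∀ {u v} → u ~ v → rank u ℕ.< rank v → ¬ (Palette ψ v ≐ Palette ψ u)
  distinct-earlier normal {u} {v} u~v u<v (⊆ , ⊇) with has-parent u~v u<v | any? (λ w → parent? w v)
  ... | p , pv | yes child with last-child child
  ...   | w , pw , last = distinguish (plain pw ¬starred) last u u~v u<v (⊆ , ⊇)
    where
    ¬starred : ¬ Starred w v
    ¬starred (_ , root) = contradiction (trans (sym pv) root) λ ()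
  distinct-earlier normal {u} {v} u~v u<v (⊆ , ⊇) | p , pv | no childless with last-child (has-child u~v u<v)
  ... | w , pw , last = by-parent (parent u) refl
    where
    only : ∀ {β} → Palette ψ u β → β ≡ ψ v
    only β∈ with ⊇ β∈
    ... | inj₁ (_ , eq)     = sym eq
    ... | inj₂ (x , px , _) = contradiction (x , px) childless
    module _ (pu : parent u ≡ nothing) where
      ψv≡0 : ψ v ≡ zero
      ψv≡0 = trans (sym (only (inj₂ (w , pw , refl)))) (proj₁ (good w u pw) (last , pu))
      -- Only starred edges carry `zero`, so `v` hangs from a root.
      v-starred : Starred v p
      v-starred = decidable-stable (starred? v p) (λ ¬starred → nonzero (plain pv ¬starred) ψv≡0)
      -- Both `p` and `u` are roots adjacent to `v`; the later one would separate the earlier from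
      -- `v`.
      p≡u : p ≡ u
      p≡u with <-cmp (rank p) (rank u)
      ... | tri< p<u _ _ = contradiction (parent-~ pv) (root-new pu p<u (<⇒≤ u<v))
      ... | tri≈ _ eq _  = rank-inj eq
      ... | tri> _ _ u<p = contradiction u~v (root-new (proj₂ v-starred) u<p (<⇒≤ (parent< pv)))
      pv-u : parent v ≡ just u
      pv-u = trans pv (cong just p≡u)
      only-child : ∀ x → parent x ≡ just u → x ≡ v
      only-child x px = ψ-sibling px pv-u (only (inj₂ (x , px , refl)))
    by-parent : ∀ q → parent u ≡ q → ⊥
    by-parent (just g) pu = ψ-parent pw (g , pu)
      (trans (only (inj₂ (w , pw , refl))) (sym (only (inj₁ ((g , pu) , refl)))))
    by-parent nothing  pu = ¬isolated normal u~v
      (r-neighbour pu (pv-u pu) (only-child pu) (λ x px → childless (x , px)))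
      (ℓ-neighbour pu (pv-u pu) (only-child pu) (λ x px → childless (x , px)))

  distinct : Normal → ∀ {u v} → u ~ v → ¬ (Palette ψ u ≐ Palette ψ v)
  distinct normal {u} {v} u~v (⊆ , ⊇) with <-cmp (rank u) (rank v)
  ... | tri< u<v _ _ = distinct-earlier normal u~v u<v (⊇ , ⊆)
  ... | tri≈ _ u≡v _ = ~-irrefl (rank-inj u≡v) u~v
  ... | tri> _ _ v<u = distinct-earlier normal (~-sym u~v) v<u (⊆ , ⊇)

-- Overlaying the forest colours on the proper colouring

module _ (G : Graph) where
  open Graph G

  module SymmetricColouring {k : ℕ} (c : Vertex → Vertex → Fin k)
    (c-sym : ∀ {x y} → x ~ y → c x y ≡ c y x)
    (c-proper : ∀ {x y z} → x ~ y → x ~ z → c x y ≡ c x z → y ≡ z) where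

    Seen : Vertex → Fin k → Set
    Seen x α = ∃[ y ] (x ~ y × c x y ≡ α)

    φ : Edge → Fin k
    φ e = c (lower e) (upper e)

    ends : ∀ e → lower e ~ upper e
    ends (edge l u _ l~u) = recompute (l ~? u) l~u

    ordered-ends : ∀ e → lower e Fin.< upper e
    ordered-ends (edge l u l<u _) = recompute (l Fin.<? u) l<u

    edge-≡ : ∀ {e f} → lower e ≡ lower f → upper e ≡ upper f → e ≡ f
    edge-≡ refl refl = refl

    proper : ProperEdgeColouring k φ
    proper v e f e≢f (inj₁ refl) (inj₁ v≡l) eq = e≢f (edge-≡ v≡l
      (c-proper (ends e) (subst (_~ upper f) (sym v≡l) (ends f)) (trans eq (cong (λ x → c x (upper f)) (sym v≡l)))))
    proper v e f e≢f (inj₂ refl) (inj₂ v≡u) eq = e≢f (edge-≡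
      (c-proper (~-sym (ends e)) (subst (_~ lower f) (sym v≡u) (~-sym (ends f)))
        (trans (sym (c-sym (ends e))) (trans eq (trans (c-sym (ends f)) (cong (λ x → c x (lower f)) (sym v≡u))))))
      v≡u)
    proper v e f e≢f (inj₁ refl) (inj₂ v≡u) eq = <⇒≯ (ordered-ends e)
      (subst₂ Fin._<_ (sym same) (sym v≡u) (ordered-ends f))
      where
      same : upper e ≡ lower f
      same = c-proper (ends e) (subst (_~ lower f) (sym v≡u) (~-sym (ends f)))
        (trans eq (trans (c-sym (ends f)) (cong (λ x → c x (lower f)) (sym v≡u))))
    proper v e f e≢f (inj₂ refl) (inj₁ v≡l) eq = <⇒≯ (ordered-ends e)
      (subst₂ Fin._<_ (sym v≡l) (sym same) (ordered-ends f))
      where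
      same : lower e ≡ upper f
      same = c-proper (~-sym (ends e)) (subst (_~ upper f) (sym v≡l) (ends f))
        (trans (sym (c-sym (ends e))) (trans eq (cong (λ x → c x (upper f)) (sym v≡l))))

    C⊆Seen : ∀ {v} → C φ v ⊆ Seen v
    C⊆Seen (e , inj₁ refl , eq) = upper e , ends e , eq
    C⊆Seen (e , inj₂ refl , eq) = lower e , ~-sym (ends e) , trans (sym (c-sym (ends e))) eq

    Seen⊆C : ∀ {v} → Seen v ⊆ C φ v
    Seen⊆C {v} (w , v~w , eq) with Fin.<-cmp v w
    ... | tri< v<w _ _ = edge v w v<w v~w , inj₁ refl , eq
    ... | tri≈ _ v≡w _ = contradiction v~w (~-irrefl v≡w)
    ... | tri> _ _ w<v = edge w v w<v (~-sym v~w) , inj₂ refl , trans (sym (c-sym v~w)) eq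

    colourable : (∀ {x y} → x ~ y → ¬ (Seen x ≐ Seen y)) → AVDColourable k
    colourable distinguished = φ , proper , λ u v u~v (⊆ , ⊇) →
      distinguished u~v ((λ s → C⊆Seen (⊆ (Seen⊆C s))) , (λ s → C⊆Seen (⊇ (Seen⊆C s))))

  module Overlay {k : ℕ} {3Δ<2k : Δ + (Δ + Δ) ℕ.< k + k}
    (m : Shannon.Partial G k 3Δ<2k) (covers : ∀ {x y} → x ~ y → Shannon.Partial.Covers m x y)
    (F : Traversals.Forest G) (ψ : Vertex → TreeColouring.Colour G F)
    (good : ∀ w → TreeColouring.Good G F w ψ) (normal : Normal) where

    open Shannon.Partial m
    open Traversals.Forest F
    open TreeColouring G F
    open Distinguishing G F ψ good

    data Kind (x y : Vertex) : Set where
      down  : parent y ≡ just x → Kind x y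
      up    : parent x ≡ just y → Kind x y
      cross : x ~ y → parent y ≢ just x → parent x ≢ just y → Kind x y

    kind : ∀ {x y} → x ~ y → Kind x y
    kind {x} {y} x~y with parent? y x | parent? x y
    ... | yes py | _      = down py
    ... | no _   | yes px = up px
    ... | no ¬py | no ¬px = cross x~y ¬py ¬px

    -- Total, with a junk value on pairs that are not adjacent.
    c : Vertex → Vertex → Fin (k + (2 + Δ))
    c x y with parent? y x | parent? x y | covers? x y
    ... | yes _ | _     | _           = k ↑ʳ ψ y
    ... | no _  | yes _ | _           = k ↑ʳ ψ x
    ... | no _  | no _  | yes (a , _) = a ↑ˡ (2 + Δ)
    ... | no _  | no _  | no _        = k ↑ʳ zero

    c-down : ∀ {x y} → parent y ≡ just x → c x y ≡ k ↑ʳ ψ y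
    c-down {x} {y} py with parent? y x | parent? x y | covers? x y
    ... | yes _  | _ | _ = refl
    ... | no ¬py | _ | _ = contradiction py ¬py

    c-up : ∀ {x y} → parent x ≡ just y → c x y ≡ k ↑ʳ ψ x
    c-up {x} {y} px with parent? y x | parent? x y | covers? x y
    ... | yes py | _      | _ = contradiction (parent< px) (<⇒≯ (parent< py))
    ... | no _   | yes _  | _ = refl
    ... | no _   | no ¬px | _ = contradiction px ¬px

    c-cross : ∀ {x y} → x ~ y → parent y ≢ just x → parent x ≢ just y →
      ∃[ a ] (mate a x ≡ y × c x y ≡ a ↑ˡ (2 + Δ))
    c-cross {x} {y} x~y ¬py ¬px with parent? y x | parent? x y | covers? x y
    ... | yes py | _      | _            = contradiction py ¬py
    ... | no _   | yes px | _            = contradiction px ¬px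
    ... | no _   | no _   | yes (a , xy) = a , xy , refl
    ... | no _   | no _   | no ¬xy       = contradiction (covers x~y) ¬xy

    ↑ˡ≢↑ʳ : ∀ {a : Fin k} {β : Colour} → a ↑ˡ (2 + Δ) ≢ k ↑ʳ β
    ↑ˡ≢↑ʳ {a} {β} eq = contradiction
      (trans (sym (splitAt-↑ˡ k a (2 + Δ))) (trans (cong (splitAt k) eq) (splitAt-↑ʳ k (2 + Δ) β))) λ ()

    c-sym : ∀ {x y} → x ~ y → c x y ≡ c y x
    c-sym {x} {y} x~y with kind x~y
    ... | down py         = trans (c-down py) (sym (c-up py))
    ... | up px           = trans (c-up px) (sym (c-down px))
    ... | cross _ ¬py ¬px with c-cross x~y ¬py ¬px | c-cross (~-sym x~y) ¬px ¬py
    ...   | a , xy , eq | b , yx , eq′ = trans eq (trans (cong (_↑ˡ (2 + Δ)) a≡b) (sym eq′))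
      where
      -- The colour is searched for separately from each end; both searches agree because no edge
      -- has two colours.
      a≡b : a ≡ b
      a≡b = mate-uniq (trans xy (sym (mate-sym yx))) (λ fixed → ~-irrefl (trans (sym fixed) xy) x~y)

    c-proper : ∀ {x y z} → x ~ y → x ~ z → c x y ≡ c x z → y ≡ z
    c-proper {x} {y} {z} x~y x~z eq with kind x~y | kind x~z
    ... | down py | down pz = ψ-sibling py pz (↑ʳ-injective k (ψ y) (ψ z) (trans (sym (c-down py)) (trans eq (c-down pz))))
    ... | down py | up px   = contradiction (↑ʳ-injective k (ψ y) (ψ x) (trans (sym (c-down py)) (trans eq (c-up px))))
                                (ψ-parent py (z , px))
    ... | up px   | down pz = contradiction (↑ʳ-injective k (ψ z) (ψ x) (trans (sym (c-down pz)) (trans (sym eq) (c-up px))))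
                                (ψ-parent pz (y , px))
    ... | up px   | up px′  = just-injective (trans (sym px) px′)
    ... | down py | cross _ ¬pz ¬px = contradiction
      (trans (sym (proj₂ (proj₂ (c-cross x~z ¬pz ¬px)))) (trans (sym eq) (c-down py))) ↑ˡ≢↑ʳ
    ... | up px   | cross _ ¬pz ¬px = contradiction
      (trans (sym (proj₂ (proj₂ (c-cross x~z ¬pz ¬px)))) (trans (sym eq) (c-up px))) ↑ˡ≢↑ʳ
    ... | cross _ ¬py ¬px | down pz = contradiction
      (trans (sym (proj₂ (proj₂ (c-cross x~y ¬py ¬px)))) (trans eq (c-down pz))) ↑ˡ≢↑ʳ
    ... | cross _ ¬py ¬px | up px   = contradiction
      (trans (sym (proj₂ (proj₂ (c-cross x~y ¬py ¬px)))) (trans eq (c-up px))) ↑ˡ≢↑ʳ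
    ... | cross _ ¬py ¬px | cross _ ¬pz ¬px′ with c-cross x~y ¬py ¬px | c-cross x~z ¬pz ¬px′
    ...   | a , xy , e | b , xz , e′ with ↑ˡ-injective (2 + Δ) a b (trans (sym e) (trans eq e′))
    ...     | refl = trans (sym xy) xz

    open SymmetricColouring c c-sym c-proper

    Seen⇒Palette : ∀ {x β} → Seen x (k ↑ʳ β) → Palette ψ x β
    Seen⇒Palette {x} {β} (y , x~y , eq) with kind x~y
    ... | down py          = inj₂ (y , py , ↑ʳ-injective k (ψ y) β (trans (sym (c-down py)) eq))
    ... | up px            = inj₁ ((y , px) , ↑ʳ-injective k (ψ x) β (trans (sym (c-up px)) eq))
    ... | cross _ ¬py ¬px  = contradiction (trans (sym (proj₂ (proj₂ (c-cross x~y ¬py ¬px)))) eq) ↑ˡ≢↑ʳ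

    Palette⇒Seen : ∀ {x β} → Palette ψ x β → Seen x (k ↑ʳ β)
    Palette⇒Seen (inj₁ ((p , px) , refl)) = p , ~-sym (parent-~ px) , c-up px
    Palette⇒Seen (inj₂ (w , pw , refl))   = w , parent-~ pw , c-down pw

    overlay-avd : AVDColourable (k + (2 + Δ))
    overlay-avd = colourable λ x~y (⊆ , ⊇) → distinct normal x~y
      ( (λ β → Seen⇒Palette (⊆ (Palette⇒Seen β)))
      , (λ β → Seen⇒Palette (⊇ (Palette⇒Seen β))))

-- Decidability of colourability

-- The functions are numbered by `funToFin`, and decoding a number recovers a function only
-- pointwise; `resp` bridges the gap.
any-function? : ∀ {m k} {P : (Fin m → Fin k) → Set} →
  (∀ {f g} → (∀ i → f i ≡ g i) → P f → P g) → (∀ f → Dec (P f)) → Dec (∃[ f ] P f)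
any-function? resp P? = map′
  (λ (i , p) → finToFun i , p)
  (λ (f , p) → funToFin f , resp (λ i → sym (finToFun-funToFin f i)) p)
  (any? (λ i → P? (finToFun i)))

avd-colourable : ∀ G → Graph.Normal G → ∀ {k} → Graph.Δ G + (Graph.Δ G + Graph.Δ G) ℕ.< k + k →
  Graph.AVDColourable G (k + (2 + Graph.Δ G))
avd-colourable G normal {k} 3Δ<2k with Shannon.complete G k 3Δ<2k | Traversals.forest G
... | m , covers | F with TreeColouring.good-colouring G F
...   | ψ , good = Overlay.overlay-avd G m covers F ψ good normal

module Decision (G : Graph) where
  open Graph G

  any-edge? : ∀ {P : Edge → Set} → (∀ e → Dec (P e)) → Dec (∃[ e ] P e)
  any-edge? {P} P? = map′
    (λ (l , u , l<u , l~u , p) → edge l u l<u l~u , p)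
    (λ (e , p) → lower e , upper e , explicit e p)
    (any? (λ l → any? (λ u → between l u)))
    where
    Between : Vertex → Vertex → Set
    Between l u = Σ (l Fin.< u) λ l<u → Σ (l ~ u) λ l~u → P (edge l u l<u l~u)
    explicit : ∀ e → P e → Between (lower e) (upper e)
    explicit (edge l u l<u l~u) p = recompute (l Fin.<? u) l<u , recompute (l ~? u) l~u , p
    between : ∀ l u → Dec (Between l u)
    between l u with l Fin.<? u | l ~? u
    ... | no l≮u  | _       = no (λ (l<u , _) → l≮u l<u)
    ... | yes _   | no l≁u  = no (λ (_ , l~u , _) → l≁u l~u)
    ... | yes l<u | yes l~u = map′ (λ p → l<u , l~u , p) (λ (_ , _ , p) → p) (P? (edge l u l<u l~u))

  all-edges? : ∀ {P : Edge → Set} → (∀ e → Dec (P e)) → Dec (∀ e → P e)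
  all-edges? P? = map′
    (λ none e → decidable-stable (P? e) (λ ¬p → none (e , ¬p)))
    (λ all (e , ¬p) → ¬p (all e))
    (¬? (any-edge? (λ e → ¬? (P? e))))

  _≟ᴱ_ : (e f : Edge) → Dec (e ≡ f)
  edge l u _ _ ≟ᴱ edge l′ u′ _ _ = map′ (λ { (refl , refl) → refl }) (λ { refl → refl , refl })
    ((l ≟ l′) ×-dec (u ≟ u′))

  incident? : ∀ v e → Dec (Incident v e)
  incident? v e = (v ≟ lower e) ⊎-dec (v ≟ upper e)

  module _ {k : ℕ} where

    C? : ∀ (φ : Edge → Fin k) v α → Dec (C φ v α)
    C? φ v α = any-edge? (λ e → incident? v e ×-dec (φ e ≟ α))

    C⊆? : ∀ (φ : Edge → Fin k) u v → Dec (C φ u ⊆ C φ v)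
    C⊆? φ u v = map′ (λ sub {α} → sub α) (λ sub α → sub {α}) (all? (λ α → C? φ u α →-dec C? φ v α))

    avd? : ∀ φ → Dec (AdjacentVertexDistinguishing k φ)
    avd? φ =
      all? (λ v → all-edges? (λ e → all-edges? (λ f → ¬? (e ≟ᴱ f) →-dec
        (incident? v e →-dec (incident? v f →-dec ¬? (φ e ≟ φ f))))))
      ×-dec
      all? (λ u → all? (λ v → (u ~? v) →-dec ¬? (C⊆? φ u v ×-dec C⊆? φ v u)))

    C-cong : ∀ {φ φ′ : Edge → Fin k} → (∀ e → φ e ≡ φ′ e) → ∀ {v} → C φ v ⊆ C φ′ v
    C-cong φ≗φ′ (e , v∈e , eq) = e , v∈e , trans (sym (φ≗φ′ e)) eq

    avd-cong : ∀ {φ φ′ : Edge → Fin k} → (∀ e → φ e ≡ φ′ e) →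
      AdjacentVertexDistinguishing k φ → AdjacentVertexDistinguishing k φ′
    avd-cong φ≗φ′ (proper , distinguished) =
      (λ v e f e≢f v∈e v∈f eq → proper v e f e≢f v∈e v∈f (trans (φ≗φ′ e) (trans eq (sym (φ≗φ′ f))))) ,
      (λ u v u~v (⊆ , ⊇) → distinguished u v u~v
        ( (λ c → C-cong (sym ∘ φ≗φ′) (⊆ (C-cong φ≗φ′ c)))
        , (λ c → C-cong (sym ∘ φ≗φ′) (⊇ (C-cong φ≗φ′ c)))))

  -- Square matrices indexed by pairs of vertices replace edge colourings in the enumeration;
  -- entries that belong to no edge are never read.
  from-matrix : ∀ {k} → (Fin (order ℕ.* order) → Fin k) → Edge → Fin k
  from-matrix f e = f (combine (lower e) (upper e))

  entry : ∀ {k} → Fin k → (Edge → Fin k) → Vertex × Vertex → Fin k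
  entry default φ (l , u) with l Fin.<? u | l ~? u
  ... | yes l<u | yes l~u = φ (edge l u l<u l~u)
  ... | yes _   | no _    = default
  ... | no _    | _       = default

  entry-edge : ∀ {k} (default : Fin k) φ e → φ e ≡ entry default φ (lower e , upper e)
  entry-edge default φ (edge l u l<u l~u) with l Fin.<? u | l ~? u
  ... | yes _  | yes _  = refl
  ... | yes _  | no l≁u = contradiction (recompute (l ~? u) l~u) l≁u
  ... | no l≮u | _      = contradiction (recompute (l Fin.<? u) l<u) l≮u

  to-matrix : ∀ {k} → Fin k → (Edge → Fin k) → Fin (order ℕ.* order) → Fin k
  to-matrix default φ = entry default φ ∘ remQuot order

  from-to-matrix : ∀ {k} (default : Fin k) φ e → φ e ≡ from-matrix (to-matrix default φ) e
  from-to-matrix default φ e = trans (entry-edge default φ e)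
    (cong (entry default φ) (sym (remQuot-combine (lower e) (upper e))))

  -- Turning a colouring into a matrix needs some colour for the pairs that are no edges. Without
  -- any colour, an edge rules out every colouring, and an edgeless graph has just the empty one to
  -- test.
  avd-colourable? : ∀ k → Dec (AVDColourable k)
  avd-colourable? k with any? {n = k} (λ _ → yes tt)
  ... | yes (default , _) = map′
    (λ (f , avd) → from-matrix f , avd)
    (λ (φ , avd) → to-matrix default φ , avd-cong (from-to-matrix default φ) avd)
    (any-function? (λ f≗g → avd-cong (λ e → f≗g (combine (lower e) (upper e)))) (λ f → avd? (from-matrix f)))
  ... | no empty with any-edge? (λ _ → yes tt)
  ...   | yes (e , _) = no (λ (φ , _) → empty (φ e , tt))
  ...   | no no-edge  = map′ (λ avd → φ₀ , avd)
    (λ (φ , avd) → avd-cong (λ e → contradiction (e , tt) no-edge) avd) (avd? φ₀)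
    where
    φ₀ : Edge → Fin k
    φ₀ e = contradiction (e , tt) no-edge

-- Arithmetic and conclusion

-- For n = 3Δ this supplies the condition 3Δ < 2k of `Shannon` with k = ⌊3Δ/2⌋ + 1, the least k that
-- satisfies it.
n<2+2⌊n/2⌋ : ∀ n → n ℕ.< suc ⌊ n /2⌋ + suc ⌊ n /2⌋
n<2+2⌊n/2⌋ n = s≤s (begin
  n                         ≡⟨ ⌊n/2⌋+⌈n/2⌉≡n n ⟨
  ⌊ n /2⌋ + ⌈ n /2⌉         ≤⟨ +-monoʳ-≤ ⌊ n /2⌋ (⌊n/2⌋-mono (n≤1+n (suc n))) ⟩
  ⌊ n /2⌋ + suc ⌊ n /2⌋     ∎)
  where open ≤-Reasoning

2⌊n/2⌋≤n : ∀ n → ⌊ n /2⌋ + ⌊ n /2⌋ ℕ.≤ n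
2⌊n/2⌋≤n n = ≤-trans (+-monoʳ-≤ ⌊ n /2⌋ (⌊n/2⌋≤⌈n/2⌉ n)) (≤-reflexive (⌊n/2⌋+⌈n/2⌉≡n n))

total≤ : ∀ δ → let k = suc ⌊ δ + (δ + δ) /2⌋ + (2 + δ) in k + k ℕ.≤ 5 ℕ.* (δ + 2)
total≤ δ = begin
  suc h + (2 + δ) + (suc h + (2 + δ)) ≡⟨ regroup h δ ⟩
  h + h + (6 + (δ + δ))               ≤⟨ +-monoˡ-≤ (6 + (δ + δ)) (2⌊n/2⌋≤n (δ + (δ + δ))) ⟩
  -- Twice the number of colours is at most 5Δ + 6, which leaves 4 to spare.
  δ + (δ + δ) + (6 + (δ + δ))         ≤⟨ m≤m+n _ 4 ⟩
  δ + (δ + δ) + (6 + (δ + δ)) + 4     ≡⟨ collect δ ⟩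
  5 ℕ.* (δ + 2)                       ∎
  where
  open ≤-Reasoning
  open +-*-Solver
  h = ⌊ δ + (δ + δ) /2⌋
  regroup : ∀ h δ → suc h + (2 + δ) + (suc h + (2 + δ)) ≡ h + h + (6 + (δ + δ))
  regroup = solve 2 (λ h δ → con 1 :+ h :+ (con 2 :+ δ) :+ (con 1 :+ h :+ (con 2 :+ δ)) :=
                            h :+ h :+ (con 6 :+ (δ :+ δ))) refl
  collect : ∀ δ → δ + (δ + δ) + (6 + (δ + δ)) + 4 ≡ 5 ℕ.* (δ + 2)
  collect = solve 1 (λ δ → δ :+ (δ :+ δ) :+ (con 6 :+ (δ :+ δ)) :+ con 4 := con 5 :* (δ :+ con 2)) refl

avd-chromatic-index : ∀ G {k} → Graph.AVDColourable G k →
  ∃[ χ ] (Graph.IsAVDChromaticIndex G χ × χ ℕ.≤ k)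
avd-chromatic-index G {k} k-colourable = map₂
  (λ (χ-colourable , minimal) → (χ-colourable , minimal) , minimal k k-colourable)
  (least (Decision.avd-colourable? G) k k-colourable)

-- For unnormalised fractions the inequality is its cross-multiplied form 2m ≤ 5d; normalised ones
-- would bring in greatest common divisors.
≤5/2* : ∀ m d → m ℕ.+ m ℕ.≤ 5 ℕ.* d → (+ m) / 1 ≤ ((+ 5) / 2) * ((+ d) / 1)
≤5/2* m d 2m≤5d = toℚᵘ-cancel-≤ (begin
  toℚᵘ ((+ m) / 1)                        ≃⟨ toℚᵘ-fromℚᵘ (mkℚᵘ (+ m) 0) ⟩
  mkℚᵘ (+ m) 0                            ≤⟨ *≤* numerators ⟩
  mkℚᵘ (+ 5) 1 ℚᵘ.* mkℚᵘ (+ d) 0          ≃⟨ ℚᵘ.*-cong (toℚᵘ-fromℚᵘ (mkℚᵘ (+ 5) 1)) (toℚᵘ-fromℚᵘ (mkℚᵘ (+ d) 0)) ⟨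
  toℚᵘ ((+ 5) / 2) ℚᵘ.* toℚᵘ ((+ d) / 1)  ≃⟨ toℚᵘ-homo-* ((+ 5) / 2) ((+ d) / 1) ⟨
  toℚᵘ (((+ 5) / 2) * ((+ d) / 1))        ∎)
  where
  open ℚᵘ.≤-Reasoning
  numerators : (+ m) ℤ.* (+ 2) ℤ.≤ ((+ 5) ℤ.* (+ d)) ℤ.* (+ 1)
  numerators = subst₂ ℤ._≤_
    (trans (cong +_ (trans (cong (m ℕ.+_) (sym (+-identityʳ m))) (*-comm 2 m))) (ℤ.pos-* m 2))
    (trans (ℤ.pos-* 5 d) (sym (ℤ.*-identityʳ _)))
    (ℤ.+≤+ 2m≤5d)

theorem2p4 : (G : Graph) → Graph.NoIsolatedVertices G → Graph.Normal G →
    ∃[ χ′ₐ ] (Graph.IsAVDChromaticIndex G χ′ₐ ×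
    (+ χ′ₐ) / 1 ≤ ((+ 5) / 2) * ((+ (Graph.Δ G ℕ.+ 2)) / 1))
theorem2p4 G _ normal = map₂
  (λ {χ} (is-index , χ≤k) → is-index , ≤5/2* χ (Δ ℕ.+ 2) (≤-trans (+-mono-≤ χ≤k χ≤k) (total≤ Δ)))
  (avd-chromatic-index G (avd-colourable G normal {suc ⌊ Δ + (Δ + Δ) /2⌋} (n<2+2⌊n/2⌋ (Δ + (Δ + Δ)))))
  where open Graph G using (Δ)
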